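{- Let $\mathbf{A} \in \mathbb{R}^{n\times d}$ with $i$-th row $\mathbf{a}_i^\top$, and let $1\le m\le n$. Let $S\subseteq\{1,\dots,n\}$ be (the index set of) a uniformly random sample of $m$ rows of $\mathbf{A}$, i.e. a uniformly random $m$-element subset, and let $\mathbf{S}\in\mathbb{R}^{n\times n}$ be its diagonal indicator matrix ($\mathbf{S}_{ii}=1$ for $i\in S$ and $\mathbf{S}_{ii}=0$ otherwise). Define, for each $i\in\{1,\dots,n\}$, $$\tilde\tau_i = \begin{cases} \tau_i^{\mathbf{S}\mathbf{A}}(\mathbf{A}) & \text{if } i\in S,\\[4pt] \dfrac{1}{1+\frac{1}{\tau_i^{\mathbf{S}\mathbf{A}}(\mathbf{A})}} & \text{otherwise.}\end{cases}$$ Then $\tilde\tau_i \ge \tau_i(\mathbf{A})$ for all $i$, and $$\mathbb{E}\left[\sum_{i=1}^n \tilde\tau_i\right] \le \frac{nd}{m}.$$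
   Context: For a matrix $\mathbf{M}$, $\mathbf{M}^+$ is the Moore-Penrose pseudoinverse. For $\mathbf{A}\in\mathbb{R}^{n\times d}$ with rows $\mathbf{a}_i^\top$, the leverage score of row $i$ is $\tau_i(\mathbf{A}) = \mathbf{a}_i^\top(\mathbf{A}^\top\mathbf{A})^+\mathbf{a}_i$. For a matrix $\mathbf{B}\in\mathbb{R}^{n'\times d}$, the generalized leverage score of row $i$ of $\mathbf{A}$ with respect to $\mathbf{B}$ is $\tau_i^{\mathbf{B}}(\mathbf{A}) = \mathbf{a}_i^\top(\mathbf{B}^\top\mathbf{B})^+\mathbf{a}_i$ if $\mathbf{a}_i\perp\ker(\mathbf{B})$, and $\tau_i^{\mathbf{B}}(\mathbf{A})=\infty$ otherwise. Conventions: $1/\infty=0$ and $1/0=\infty$, so $\frac{1}{1+1/t}$ equals $1$ for $t=\infty$ and $0$ for $t=0$. -}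

module Defs where

open import Level as Level using (Level; _⊔_)
open import Algebra.Bundles using (CommutativeRing)
open import Algebra.Definitions using (Invertible)
import Algebra.Definitions.RawMonoid as RawMonoid
import Algebra.Properties.Ring as RingProperties
import Algebra.Properties.Semiring.Sum as SemiringSum
open import Data.Bool.Base using (if_then_else_)
open import Data.Fin.Base using (Fin; zero; suc)
import Data.Fin.Properties as Fin
open import Data.Fin.Subset using (Subset; inside; outside; ∣_∣)
open import Data.Fin.Subset.Properties using (_∈?_)
open import Data.List.Base as List using (List; []; _∷_; _++_; length; filter)
open import Data.List.Membership.Propositional using (_∈_)
open import Data.List.Membership.Propositional.Properties using (∈-allFin)
open import Data.List.Relation.Unary.Any using (here; there)
open import Data.Nat.Base as ℕ using (ℕ; zero; suc)
import Data.Nat.Properties as ℕ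
open import Data.Product.Base using (Σ-syntax; ∃; ∃-syntax; _×_; _,_; proj₁; proj₂)
open import Data.Sum.Base using (_⊎_; inj₁; inj₂)
open import Data.Vec.Base as Vec using ()
open import Data.Vec.Functional as Vector using (Vector)
open import Function.Base using (_∘_)
open import Relation.Binary.Core using (Rel)
open import Relation.Binary.PropositionalEquality.Core as ≡ using (_≡_)
import Relation.Binary.Construct.Add.Supremum.NonStrict as AddSupremum
open import Relation.Binary.Structures using (IsDecTotalOrder)
open import Relation.Nullary.Construct.Add.Supremum using (_⁺; [_]; ⊤⁺)
open import Relation.Nullary.Decidable.Core using (Dec; yes; no; does; map′; _×-dec_)
open import Relation.Nullary.Negation.Core using (¬_; contradiction)
open import Relation.Unary using (Pred)

-- The axioms of ℝ. A complete ordered field is unique up to isomorphism, so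
-- quantifying over these records is quantifying over presentations of the
-- real line. The decidable order is that of the classical reals.

record CompleteOrderedField (c ℓ₁ ℓ₂ : Level) : Set (Level.suc (c ⊔ ℓ₁ ⊔ ℓ₂)) where
  infix 4 _≤_
  field
    commutativeRing : CommutativeRing c ℓ₁

  open CommutativeRing commutativeRing public

  field
    0≉1             : ¬ 0# ≈ 1#
    invertible      : ∀ x → ¬ x ≈ 0# → Invertible _≈_ 1# _*_ x
    _≤_             : Rel Carrier ℓ₂
    isDecTotalOrder : IsDecTotalOrder _≈_ _≤_
    +-monoʳ-≤       : ∀ z {x y} → x ≤ y → z + x ≤ z + y
    *-nonNegative   : ∀ {x y} → 0# ≤ x → 0# ≤ y → 0# ≤ x * y

  IsUpperBound : Pred Carrier (c ⊔ ℓ₁ ⊔ ℓ₂) → Pred Carrier (c ⊔ ℓ₁ ⊔ ℓ₂)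
  IsUpperBound P u = ∀ x → P x → x ≤ u

  field
    leastUpperBound : ∀ (P : Pred Carrier (c ⊔ ℓ₁ ⊔ ℓ₂)) → ∃ P → ∃ (IsUpperBound P) →
                      ∃[ s ] IsUpperBound P s × (∀ u → IsUpperBound P u → s ≤ u)

  open IsDecTotalOrder isDecTotalOrder public
    using (_≟_; _≤?_)
    renaming ( refl to ≤-refl; reflexive to ≤-reflexive; trans to ≤-trans
             ; antisym to ≤-antisym; total to ≤-total)

  -- Total, with the junk value 0#⁻¹ = 0#.
  infix 8 _⁻¹
  _⁻¹ : Carrier → Carrier
  x ⁻¹ with x ≟ 0#
  ... | yes _  = 0#
  ... | no x≉0 = proj₁ (invertible x x≉0)

  infixl 7 _/_
  _/_ : Carrier → Carrier → Carrier
  x / y = x * y ⁻¹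

  fromℕ : ℕ → Carrier
  fromℕ k = k ·ℕ 1#
    where open RawMonoid +-rawMonoid using () renaming (_×_ to _·ℕ_)


module LeverageScores {c ℓ₁ ℓ₂ : Level} (R : CompleteOrderedField c ℓ₁ ℓ₂) where

  open CompleteOrderedField R hiding (zero; _/_; fromℕ)
  open CompleteOrderedField R public using (_/_; fromℕ)
  open RingProperties ring
  open SemiringSum semiring
  open import Relation.Binary.Reasoning.Setoid setoid

  Matrix : ℕ → ℕ → Set c
  Matrix m n = Vector (Vector Carrier n) m

  infix 4 _≋_
  _≋_ : ∀ {m n} → Rel (Matrix m n) ℓ₁
  M ≋ N = ∀ i j → M i j ≈ N i j

  infixl 7 _⊗_
  _⊗_ : ∀ {m n p} → Matrix m n → Matrix n p → Matrix m p
  _⊗_ {n = n} M N i j = ∑[ k < n ] (M i k * N k j)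

  infixl 6 _⊕_ _⊖_
  _⊕_ _⊖_ : ∀ {m n} → Matrix m n → Matrix m n → Matrix m n
  (M ⊕ N) i j = M i j + N i j
  (M ⊖ N) i j = M i j - N i j

  infix 8 _ᵀ
  _ᵀ : ∀ {m n} → Matrix m n → Matrix n m
  (M ᵀ) i j = M j i

  infix 7 _∙_
  _∙_ : ∀ {n} → Vector Carrier n → Vector Carrier n → Carrier
  _∙_ {n} u v = ∑[ k < n ] (u k * v k)

  record MoorePenrose {m n} (M : Matrix m n) : Set (c ⊔ ℓ₁) where
    field
      inverse     : Matrix n m
      M⊗P⊗M       : M ⊗ inverse ⊗ M ≋ M
      P⊗M⊗P       : inverse ⊗ M ⊗ inverse ≋ inverse
      M⊗P-sym     : (M ⊗ inverse) ᵀ ≋ M ⊗ inverse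
      P⊗M-sym     : (inverse ⊗ M) ᵀ ≋ inverse ⊗ M

  _⊥ker_ : ∀ {m n} → Vector Carrier n → Matrix m n → Set (c ⊔ ℓ₁)
  a ⊥ker B = ∀ x → (∀ i → B i ∙ x ≈ 0#) → a ∙ x ≈ 0#

  ≋-trans : ∀ {m n} {M N P : Matrix m n} → M ≋ N → N ≋ P → M ≋ P
  ≋-trans p q i j = trans (p i j) (q i j)

  ≋-sym : ∀ {m n} {M N : Matrix m n} → M ≋ N → N ≋ M
  ≋-sym p i j = sym (p i j)

  ⊗-cong : ∀ {m n p} {M M′ : Matrix m n} {N N′ : Matrix n p} → M ≋ M′ → N ≋ N′ → M ⊗ N ≋ M′ ⊗ N′
  ⊗-cong p q i j = sum-cong-≋ (λ k → *-cong (p i k) (q k j))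

  ⊗-congˡ : ∀ {m n p} (M : Matrix m n) {N N′ : Matrix n p} → N ≋ N′ → M ⊗ N ≋ M ⊗ N′
  ⊗-congˡ M q = ⊗-cong {M = M} (λ _ _ → refl) q

  ⊗-congʳ : ∀ {m n p} {M M′ : Matrix m n} (N : Matrix n p) → M ≋ M′ → M ⊗ N ≋ M′ ⊗ N
  ⊗-congʳ N p = ⊗-cong {N = N} p (λ _ _ → refl)

  ⊗-assoc : ∀ {m n p q} (M : Matrix m n) (N : Matrix n p) (P : Matrix p q) →
            M ⊗ N ⊗ P ≋ M ⊗ (N ⊗ P)
  ⊗-assoc {n = n} {p} M N P i j = begin
    ∑[ l < p ] (∑[ k < n ] (M i k * N k l) * P l j)
      ≈⟨ sum-cong-≋ (λ l → *-distribʳ-sum (P l j) (λ k → M i k * N k l)) ⟩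
    ∑[ l < p ] ∑[ k < n ] (M i k * N k l * P l j)
      ≈⟨ ∑-comm (λ l k → M i k * N k l * P l j) ⟩
    ∑[ k < n ] ∑[ l < p ] (M i k * N k l * P l j)
      ≈⟨ sum-cong-≋ (λ k → sum-cong-≋ (λ l → *-assoc (M i k) (N k l) (P l j))) ⟩
    ∑[ k < n ] ∑[ l < p ] (M i k * (N k l * P l j))
      ≈⟨ sum-cong-≋ (λ k → *-distribˡ-sum (M i k) (λ l → N k l * P l j)) ⟨
    ∑[ k < n ] (M i k * ∑[ l < p ] (N k l * P l j)) ∎

  ᵀ-⊗ : ∀ {m n p} (M : Matrix m n) (N : Matrix n p) → (M ⊗ N) ᵀ ≋ N ᵀ ⊗ M ᵀ
  ᵀ-⊗ M N i j = sum-cong-≋ (λ k → *-comm (M j k) (N k i))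

  ∑-zero : ∀ {n} {f : Vector Carrier n} → (∀ i → f i ≈ 0#) → sum f ≈ 0#
  ∑-zero {n} f≈0 = trans (sum-cong-≋ f≈0) (sum-replicate-zero n)

  ∑-neg : ∀ {n} (f : Vector Carrier n) → ∑[ i < n ] (- f i) ≈ - sum f
  ∑-neg {zero}  f = sym -0#≈0#
  ∑-neg {suc n} f = trans (+-congˡ (∑-neg (f ∘ suc))) (-‿+-comm _ _)

  ∑-minus : ∀ {n} (f g : Vector Carrier n) → ∑[ i < n ] (f i - g i) ≈ sum f - sum g
  ∑-minus f g = trans (∑-distrib-+ f (λ i → - g i)) (+-congˡ (∑-neg g))

  ⊗-distribˡ-⊕ : ∀ {m n p} (M : Matrix m n) (N P : Matrix n p) → M ⊗ (N ⊕ P) ≋ M ⊗ N ⊕ M ⊗ P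
  ⊗-distribˡ-⊕ M N P i j = trans (sum-cong-≋ (λ k → distribˡ (M i k) (N k j) (P k j)))
                                 (∑-distrib-+ (λ k → M i k * N k j) (λ k → M i k * P k j))

  ⊗-distribʳ-⊕ : ∀ {m n p} (P : Matrix n p) (M N : Matrix m n) → (M ⊕ N) ⊗ P ≋ M ⊗ P ⊕ N ⊗ P
  ⊗-distribʳ-⊕ P M N i j = trans (sum-cong-≋ (λ k → distribʳ (P k j) (M i k) (N i k)))
                                 (∑-distrib-+ (λ k → M i k * P k j) (λ k → N i k * P k j))

  ⊗-distribˡ-⊖ : ∀ {m n p} (M : Matrix m n) (N P : Matrix n p) → M ⊗ (N ⊖ P) ≋ M ⊗ N ⊖ M ⊗ P
  ⊗-distribˡ-⊖ M N P i j = trans (sum-cong-≋ (λ k → x[y-z]≈xy-xz (M i k) (N k j) (P k j)))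
                                 (∑-minus (λ k → M i k * N k j) (λ k → M i k * P k j))

  ⊗-distribʳ-⊖ : ∀ {m n p} (P : Matrix n p) (M N : Matrix m n) → (M ⊖ N) ⊗ P ≋ M ⊗ P ⊖ N ⊗ P
  ⊗-distribʳ-⊖ P M N i j = trans (sum-cong-≋ (λ k → [y-z]x≈yx-zx (P k j) (M i k) (N i k)))
                                 (∑-minus (λ k → M i k * P k j) (λ k → N i k * P k j))

  ⊖-cong : ∀ {m n} {M M′ N N′ : Matrix m n} → M ≋ M′ → N ≋ N′ → M ⊖ N ≋ M′ ⊖ N′
  ⊖-cong p q i j = +-cong (p i j) (-‿cong (q i j))

  δ : ∀ {n} → Fin n → Fin n → Carrier
  δ i j = if does (i Fin.≟ j) then 1# else 0#

  ∑-δ : ∀ {n} (f : Vector Carrier n) k → ∑[ i < n ] (f i * δ i k) ≈ f k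
  ∑-δ f zero    = trans (+-cong (*-identityʳ (f zero)) (∑-zero (λ i → zeroʳ (f (suc i)))))
                        (+-identityʳ (f zero))
  ∑-δ f (suc k) = trans (+-cong (zeroʳ (f zero)) (∑-δ (f ∘ suc) k)) (+-identityˡ (f (suc k)))

  ⁻¹-inverseʳ : ∀ {x} → ¬ x ≈ 0# → x * x ⁻¹ ≈ 1#
  ⁻¹-inverseʳ {x} x≉0 with x ≟ 0#
  ... | yes x≈0 = contradiction x≈0 x≉0
  ... | no x≉0′ = proj₂ (proj₂ (invertible x x≉0′))

  x-y≈0⇒x≈y : ∀ {x y} → x - y ≈ 0# → x ≈ y
  x-y≈0⇒x≈y {x} {y} p = begin
    x              ≈⟨ +-identityʳ x ⟨
    x + 0#         ≈⟨ +-congˡ (-‿inverseˡ y) ⟨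
    x + (- y + y)  ≈⟨ +-assoc x (- y) y ⟨
    x - y + y      ≈⟨ +-congʳ p ⟩
    0# + y         ≈⟨ +-identityˡ y ⟩
    y              ∎

  x≈y⇒x-y≈0 : ∀ {x y} → x ≈ y → x - y ≈ 0#
  x≈y⇒x-y≈0 {y = y} p = trans (+-congʳ p) (-‿inverseʳ y)

  x*x≥0 : ∀ x → 0# ≤ x * x
  x*x≥0 x with ≤-total 0# x
  ... | inj₁ 0≤x = *-nonNegative 0≤x 0≤x
  ... | inj₂ x≤0 = ≤-trans (*-nonNegative 0≤-x 0≤-x) (≤-reflexive -x*-x≈x*x)
    where
    0≤-x : 0# ≤ - x
    0≤-x = ≤-trans (≤-reflexive (sym (-‿inverseˡ x)))
             (≤-trans (+-monoʳ-≤ (- x) x≤0) (≤-reflexive (+-identityʳ (- x))))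
    -x*-x≈x*x : - x * - x ≈ x * x
    -x*-x≈x*x = begin
      - x * - x    ≈⟨ -‿distribˡ-* x (- x) ⟨
      - (x * - x)  ≈⟨ -‿cong (-‿distribʳ-* x x) ⟨
      - - (x * x)  ≈⟨ -‿involutive (x * x) ⟩
      x * x        ∎

  x*x≈0⇒x≈0 : ∀ {x} → x * x ≈ 0# → x ≈ 0#
  x*x≈0⇒x≈0 {x} p with x ≟ 0#
  ... | yes x≈0 = x≈0
  ... | no  x≉0 = begin
    x               ≈⟨ *-identityʳ x ⟨
    x * 1#          ≈⟨ *-congˡ (⁻¹-inverseʳ x≉0) ⟨
    x * (x * x ⁻¹)  ≈⟨ *-assoc x x (x ⁻¹) ⟨
    x * x * x ⁻¹    ≈⟨ *-congʳ p ⟩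
    0# * x ⁻¹       ≈⟨ zeroˡ (x ⁻¹) ⟩
    0#              ∎

  x≤x+y : ∀ x {y} → 0# ≤ y → x ≤ x + y
  x≤x+y x 0≤y = ≤-trans (≤-reflexive (sym (+-identityʳ x))) (+-monoʳ-≤ x 0≤y)

  ∑-nonNegative : ∀ {n} {f : Vector Carrier n} → (∀ i → 0# ≤ f i) → 0# ≤ sum f
  ∑-nonNegative {zero}  f≥0 = ≤-refl
  ∑-nonNegative {suc n} f≥0 = ≤-trans (f≥0 zero) (x≤x+y _ (∑-nonNegative (f≥0 ∘ suc)))

  ∑≈0⇒≈0 : ∀ {n} {f : Vector Carrier n} → (∀ i → 0# ≤ f i) → sum f ≈ 0# → ∀ i → f i ≈ 0#
  ∑≈0⇒≈0 {f = f} f≥0 p zero = ≤-antisym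
    (≤-trans (x≤x+y (f zero) (∑-nonNegative (f≥0 ∘ suc))) (≤-reflexive p)) (f≥0 zero)
  ∑≈0⇒≈0 {suc n} {f} f≥0 p (suc i) = ∑≈0⇒≈0 (f≥0 ∘ suc) tail≈0 i
    where
    tail≈0 : sum (f ∘ suc) ≈ 0#
    tail≈0 = begin
      sum (f ∘ suc)           ≈⟨ +-identityˡ _ ⟨
      0# + sum (f ∘ suc)      ≈⟨ +-congʳ (∑≈0⇒≈0 f≥0 p zero) ⟨
      f zero + sum (f ∘ suc)  ≈⟨ p ⟩
      0#                      ∎

  Dᵀ⊗D≋0⇒D≋0 : ∀ {m n} (D : Matrix m n) → (∀ i j → (D ᵀ ⊗ D) i j ≈ 0#) → ∀ i j → D i j ≈ 0#
  Dᵀ⊗D≋0⇒D≋0 D p i j =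
    x*x≈0⇒x≈0 (∑≈0⇒≈0 {f = λ k → D k j * D k j} (λ k → x*x≥0 (D k j)) (p j j) i)

  Regular : ∀ {m n} → Matrix m n → Set (c ⊔ ℓ₁)
  Regular {m} {n} M = Σ[ G ∈ Matrix n m ] M ⊗ G ⊗ M ≋ M

  -- If M - M Y M has the inner inverse Z, then M has the inner inverse
  -- Y + (1 - Y M) Z (1 - M Y).
  regular-step : ∀ {m n} (M : Matrix m n) (Y : Matrix n m) → Regular (M ⊖ M ⊗ Y ⊗ M) → Regular M
  regular-step {m} {n} M Y (Z , M′ZM′≋M′) = Y ⊕ U , MGM≋M
    where
    M′ : Matrix m n
    M′ = M ⊖ M ⊗ Y ⊗ M
    W U : Matrix n m
    W = Z ⊖ Y ⊗ (M ⊗ Z)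
    U = W ⊖ W ⊗ (M ⊗ Y)

    MW≋M′Z : M ⊗ W ≋ M′ ⊗ Z
    MW≋M′Z i j = begin
      (M ⊗ W) i j                                ≈⟨ ⊗-distribˡ-⊖ M Z (Y ⊗ (M ⊗ Z)) i j ⟩
      (M ⊗ Z) i j - (M ⊗ (Y ⊗ (M ⊗ Z))) i j      ≈⟨ +-congˡ (-‿cong (⊗-assoc M Y (M ⊗ Z) i j)) ⟨
      (M ⊗ Z) i j - (M ⊗ Y ⊗ (M ⊗ Z)) i j        ≈⟨ +-congˡ (-‿cong (⊗-assoc (M ⊗ Y) M Z i j)) ⟨
      (M ⊗ Z) i j - (M ⊗ Y ⊗ M ⊗ Z) i j          ≈⟨ ⊗-distribʳ-⊖ Z M (M ⊗ Y ⊗ M) i j ⟨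
      (M′ ⊗ Z) i j                               ∎

    UM≋WM′ : U ⊗ M ≋ W ⊗ M′
    UM≋WM′ i j = begin
      (U ⊗ M) i j                                ≈⟨ ⊗-distribʳ-⊖ M W (W ⊗ (M ⊗ Y)) i j ⟩
      (W ⊗ M) i j - (W ⊗ (M ⊗ Y) ⊗ M) i j        ≈⟨ +-congˡ (-‿cong (⊗-assoc W (M ⊗ Y) M i j)) ⟩
      (W ⊗ M) i j - (W ⊗ (M ⊗ Y ⊗ M)) i j        ≈⟨ ⊗-distribˡ-⊖ W M (M ⊗ Y ⊗ M) i j ⟨
      (W ⊗ M′) i j                               ∎

    MGM≋M : M ⊗ (Y ⊕ U) ⊗ M ≋ M
    MGM≋M i j = begin
      (M ⊗ (Y ⊕ U) ⊗ M) i j                      ≈⟨ ⊗-congʳ M (⊗-distribˡ-⊕ M Y U) i j ⟩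
      ((M ⊗ Y ⊕ M ⊗ U) ⊗ M) i j                  ≈⟨ ⊗-distribʳ-⊕ M (M ⊗ Y) (M ⊗ U) i j ⟩
      (M ⊗ Y ⊗ M) i j + (M ⊗ U ⊗ M) i j          ≈⟨ +-congˡ (⊗-assoc M U M i j) ⟩
      (M ⊗ Y ⊗ M) i j + (M ⊗ (U ⊗ M)) i j        ≈⟨ +-congˡ (⊗-congˡ M UM≋WM′ i j) ⟩
      (M ⊗ Y ⊗ M) i j + (M ⊗ (W ⊗ M′)) i j       ≈⟨ +-congˡ (⊗-assoc M W M′ i j) ⟨
      (M ⊗ Y ⊗ M) i j + (M ⊗ W ⊗ M′) i j         ≈⟨ +-congˡ (⊗-congʳ M′ MW≋M′Z i j) ⟩
      (M ⊗ Y ⊗ M) i j + (M′ ⊗ Z ⊗ M′) i j        ≈⟨ +-congˡ (M′ZM′≋M′ i j) ⟩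
      (M ⊗ Y ⊗ M) i j + M′ i j                   ≈⟨ +-congˡ (+-comm (M i j) _) ⟩
      (M ⊗ Y ⊗ M) i j + (- (M ⊗ Y ⊗ M) i j + M i j) ≈⟨ +-assoc _ _ _ ⟨
      (M ⊗ Y ⊗ M) i j - (M ⊗ Y ⊗ M) i j + M i j  ≈⟨ +-congʳ (-‿inverseʳ _) ⟩
      0# + M i j                                 ≈⟨ +-identityˡ (M i j) ⟩
      M i j                                      ∎

  -- Rank-one elimination with pivot M k l, clearing row k.
  regular-rows : ∀ {m n} (ks : List (Fin m)) (M : Matrix m n) →
                 (∀ i → i ∈ ks ⊎ (∀ j → M i j ≈ 0#)) → Regular M
  regular-rows [] M rows = (λ _ _ → 0#) , λ i j → trans
    (∑-zero (λ k → trans (*-congˡ (zeroRow k j)) (zeroʳ _))) (sym (zeroRow i j))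
    where
    zeroRow : ∀ i j → M i j ≈ 0#
    zeroRow i with rows i
    ... | inj₂ M≈0 = M≈0
  regular-rows {m} {n} (k ∷ ks) M rows with Fin.all? (λ j → M k j ≟ 0#)
  ... | yes Mₖ≈0 = regular-rows ks M rows′
    where
    rows′ : ∀ i → i ∈ ks ⊎ (∀ j → M i j ≈ 0#)
    rows′ i with rows i
    ... | inj₁ (here ≡.refl) = inj₂ Mₖ≈0
    ... | inj₁ (there i∈ks)  = inj₁ i∈ks
    ... | inj₂ Mᵢ≈0          = inj₂ Mᵢ≈0
  ... | no Mₖ≉0 = regular-step M Y (regular-rows ks (M ⊖ M ⊗ Y ⊗ M) rows′)
    where
    pivot : ∃[ l ] ¬ M k l ≈ 0#
    pivot = Fin.¬∀⟶∃¬ n _ (λ j → M k j ≟ 0#) Mₖ≉0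
    l : Fin n
    l = proj₁ pivot
    p : Carrier
    p = M k l
    Y : Matrix n m
    Y i j = δ i l * (p ⁻¹ * δ j k)

    MY : ∀ i j → (M ⊗ Y) i j ≈ M i l * p ⁻¹ * δ j k
    MY i j = begin
      ∑[ h < n ] (M i h * (δ h l * (p ⁻¹ * δ j k)))  ≈⟨ sum-cong-≋ (λ h → *-assoc (M i h) _ _) ⟨
      ∑[ h < n ] (M i h * δ h l * (p ⁻¹ * δ j k))    ≈⟨ *-distribʳ-sum _ (λ h → M i h * δ h l) ⟨
      ∑[ h < n ] (M i h * δ h l) * (p ⁻¹ * δ j k)    ≈⟨ *-congʳ (∑-δ (M i) l) ⟩
      M i l * (p ⁻¹ * δ j k)                         ≈⟨ *-assoc _ _ _ ⟨
      M i l * p ⁻¹ * δ j k                           ∎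

    MYM : ∀ i j → (M ⊗ Y ⊗ M) i j ≈ M i l * p ⁻¹ * M k j
    MYM i j = begin
      ∑[ h < m ] ((M ⊗ Y) i h * M h j)               ≈⟨ sum-cong-≋ (λ h → *-congʳ (MY i h)) ⟩
      ∑[ h < m ] (M i l * p ⁻¹ * δ h k * M h j)      ≈⟨ sum-cong-≋ {m} (λ h → trans (*-assoc (M i l * p ⁻¹) (δ h k) (M h j)) (*-congˡ (*-comm (δ h k) (M h j)))) ⟩
      ∑[ h < m ] (M i l * p ⁻¹ * (M h j * δ h k))    ≈⟨ *-distribˡ-sum _ (λ h → M h j * δ h k) ⟨
      M i l * p ⁻¹ * ∑[ h < m ] (M h j * δ h k)      ≈⟨ *-congˡ (∑-δ (λ h → M h j) k) ⟩
      M i l * p ⁻¹ * M k j                           ∎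

    rows′ : ∀ i → i ∈ ks ⊎ (∀ j → (M ⊖ M ⊗ Y ⊗ M) i j ≈ 0#)
    rows′ i with rows i
    ... | inj₁ (here ≡.refl) = inj₂ λ j → x≈y⇒x-y≈0 (sym (begin
      (M ⊗ Y ⊗ M) k j  ≈⟨ MYM k j ⟩
      p * p ⁻¹ * M k j ≈⟨ *-congʳ (⁻¹-inverseʳ (proj₂ pivot)) ⟩
      1# * M k j       ≈⟨ *-identityˡ (M k j) ⟩
      M k j            ∎))
    ... | inj₁ (there i∈ks) = inj₁ i∈ks
    ... | inj₂ Mᵢ≈0         = inj₂ λ j → x≈y⇒x-y≈0 (begin
      M i j                ≈⟨ Mᵢ≈0 j ⟩
      0#                   ≈⟨ zeroˡ _ ⟨
      0# * M k j           ≈⟨ *-congʳ (zeroˡ _) ⟨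
      0# * p ⁻¹ * M k j    ≈⟨ *-congʳ (*-congʳ (Mᵢ≈0 l)) ⟨
      M i l * p ⁻¹ * M k j ≈⟨ MYM i j ⟨
      (M ⊗ Y ⊗ M) i j      ∎)

  regular : ∀ {m n} (M : Matrix m n) → Regular M
  regular {m} M = regular-rows (List.allFin m) M (λ i → inj₁ (∈-allFin i))

  -- Least squares: with G an inner inverse of MᵀM, the matrix Y = (M G)ᵀ
  -- satisfies the normal equations MᵀM Y = Mᵀ.
  leastSquares : ∀ {m n} (M : Matrix m n) →
                 Σ[ Y ∈ Matrix n m ] M ⊗ Y ⊗ M ≋ M × (M ⊗ Y) ᵀ ≋ M ⊗ Y
  leastSquares {m} {n} M = Y , MYM≋M , MY-sym
    where
    H G : Matrix n n
    H = M ᵀ ⊗ M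
    G = proj₁ (regular H)
    W D : Matrix m n
    W = M ⊗ G
    D = W ⊗ H ⊖ M
    Y : Matrix n m
    Y = W ᵀ

    MᵀD≈0 : ∀ i j → (M ᵀ ⊗ D) i j ≈ 0#
    MᵀD≈0 i j = begin
      (M ᵀ ⊗ D) i j                   ≈⟨ ⊗-distribˡ-⊖ (M ᵀ) (W ⊗ H) M i j ⟩
      (M ᵀ ⊗ (W ⊗ H)) i j - H i j     ≈⟨ x≈y⇒x-y≈0 MᵀWH≈H ⟩
      0#                              ∎
      where
      MᵀWH≈H : (M ᵀ ⊗ (W ⊗ H)) i j ≈ H i j
      MᵀWH≈H = begin
        (M ᵀ ⊗ (W ⊗ H)) i j  ≈⟨ ⊗-assoc (M ᵀ) W H i j ⟨
        (M ᵀ ⊗ W ⊗ H) i j    ≈⟨ ⊗-congʳ H (⊗-assoc (M ᵀ) M G) i j ⟨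
        (H ⊗ G ⊗ H) i j      ≈⟨ proj₂ (regular H) i j ⟩
        H i j                ∎

    DᵀD≈0 : ∀ i j → (D ᵀ ⊗ D) i j ≈ 0#
    DᵀD≈0 i j = begin
      (D ᵀ ⊗ D) i j                                      ≈⟨ ⊗-distribʳ-⊖ D ((W ⊗ H) ᵀ) (M ᵀ) i j ⟩
      ((W ⊗ H) ᵀ ⊗ D) i j - (M ᵀ ⊗ D) i j                ≈⟨ +-cong WHᵀD≈0 (trans (-‿cong (MᵀD≈0 i j)) -0#≈0#) ⟩
      0# + 0#                                            ≈⟨ +-identityˡ 0# ⟩
      0#                                                 ∎
      where
      V : Matrix n n
      V = G ⊗ H
      WHᵀD≈0 : ((W ⊗ H) ᵀ ⊗ D) i j ≈ 0#
      WHᵀD≈0 = begin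
        ((W ⊗ H) ᵀ ⊗ D) i j   ≈⟨ ⊗-congʳ D (λ a b → ⊗-assoc M G H b a) i j ⟩
        ((M ⊗ V) ᵀ ⊗ D) i j   ≈⟨ ⊗-congʳ D (ᵀ-⊗ M V) i j ⟩
        (V ᵀ ⊗ M ᵀ ⊗ D) i j   ≈⟨ ⊗-assoc (V ᵀ) (M ᵀ) D i j ⟩
        (V ᵀ ⊗ (M ᵀ ⊗ D)) i j ≈⟨ ∑-zero (λ k → trans (*-congˡ (MᵀD≈0 k j)) (zeroʳ _)) ⟩
        0#                    ∎

    WH≋M : W ⊗ H ≋ M
    WH≋M i j = x-y≈0⇒x≈y (Dᵀ⊗D≋0⇒D≋0 D DᵀD≈0 i j)

    YᵀMᵀM≋M : W ⊗ M ᵀ ⊗ M ≋ M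
    YᵀMᵀM≋M = ≋-trans (⊗-assoc W (M ᵀ) M) WH≋M

    WMᵀ≋MY : W ⊗ M ᵀ ≋ M ⊗ Y
    WMᵀ≋MY i j = begin
      (W ⊗ M ᵀ) i j              ≈⟨ ⊗-congˡ W (λ a b → YᵀMᵀM≋M b a) i j ⟨
      (W ⊗ (W ⊗ M ᵀ ⊗ M) ᵀ) i j  ≈⟨ ⊗-congˡ W (ᵀ-⊗ (W ⊗ M ᵀ) M) i j ⟩
      (W ⊗ (M ᵀ ⊗ (W ⊗ M ᵀ) ᵀ)) i j ≈⟨ ⊗-congˡ W (⊗-congˡ (M ᵀ) (ᵀ-⊗ W (M ᵀ))) i j ⟩
      (W ⊗ (M ᵀ ⊗ (M ⊗ Y))) i j  ≈⟨ ⊗-assoc W (M ᵀ) (M ⊗ Y) i j ⟨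
      (W ⊗ M ᵀ ⊗ (M ⊗ Y)) i j    ≈⟨ ⊗-assoc (W ⊗ M ᵀ) M Y i j ⟨
      (W ⊗ M ᵀ ⊗ M ⊗ Y) i j      ≈⟨ ⊗-congʳ Y YᵀMᵀM≋M i j ⟩
      (M ⊗ Y) i j                ∎

    MYM≋M : M ⊗ Y ⊗ M ≋ M
    MYM≋M = ≋-trans (⊗-congʳ M (≋-sym WMᵀ≋MY)) YᵀMᵀM≋M

    MY-sym : (M ⊗ Y) ᵀ ≋ M ⊗ Y
    MY-sym = ≋-trans (ᵀ-⊗ M Y) WMᵀ≋MY

  -- The Penrose equations determine the inverse up to ≋, so clients need not
  -- see how it is constructed.
  abstract

    moorePenrose : ∀ {m n} (M : Matrix m n) → MoorePenrose M
    moorePenrose {m} {n} M with leastSquares M | leastSquares (M ᵀ)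
    ... | Y , MYM , MYsym | Z , MᵀZMᵀ , MᵀZsym = record
      { inverse = X
      ; M⊗P⊗M   = ≋-trans (⊗-congʳ M MX≋MY) MYM
      ; P⊗M⊗P   = ≋-trans (⊗-congʳ X XM≋KM) (≋-trans (≋-sym (⊗-assoc (K ⊗ M) (K ⊗ M) Y))
                    (⊗-congʳ Y (≋-trans (≋-sym (⊗-assoc (K ⊗ M) K M)) KMKM≋KM)))
      ; M⊗P-sym = λ i j → trans (MX≋MY j i) (trans (MYsym i j) (sym (MX≋MY i j)))
      ; P⊗M-sym = λ i j → trans (XM≋KM j i) (trans (KM-sym i j) (sym (XM≋KM i j)))
      }
      where
      K X : Matrix n m
      K = Z ᵀ
      X = K ⊗ M ⊗ Y

      KM≋ : K ⊗ M ≋ (M ᵀ ⊗ Z) ᵀ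
      KM≋ = ≋-sym (ᵀ-⊗ (M ᵀ) Z)

      KM-sym : (K ⊗ M) ᵀ ≋ K ⊗ M
      KM-sym i j = trans (KM≋ j i) (trans (sym (MᵀZsym i j)) (sym (KM≋ i j)))

      MKM≋M : M ⊗ (K ⊗ M) ≋ M
      MKM≋M i j = begin
        (M ⊗ (K ⊗ M)) i j         ≈⟨ ⊗-congˡ M KM≋ i j ⟩
        (M ⊗ (M ᵀ ⊗ Z) ᵀ) i j     ≈⟨ ᵀ-⊗ (M ᵀ ⊗ Z) (M ᵀ) i j ⟨
        (M ᵀ ⊗ Z ⊗ M ᵀ) j i       ≈⟨ MᵀZMᵀ j i ⟩
        M i j                     ∎

      KMKM≋KM : K ⊗ M ⊗ K ⊗ M ≋ K ⊗ M
      KMKM≋KM = ≋-trans (⊗-assoc (K ⊗ M) K M) (≋-trans (⊗-assoc K M (K ⊗ M)) (⊗-congˡ K MKM≋M))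

      MX≋MY : M ⊗ X ≋ M ⊗ Y
      MX≋MY = ≋-trans (≋-sym (⊗-assoc M (K ⊗ M) Y)) (⊗-congʳ Y MKM≋M)

      XM≋KM : X ⊗ M ≋ K ⊗ M
      XM≋KM = ≋-trans (⊗-assoc (K ⊗ M) Y M) (≋-trans (⊗-assoc K M (Y ⊗ M))
                (⊗-congˡ K (≋-trans (≋-sym (⊗-assoc M Y M)) MYM)))

  infix 8 _†
  _† : ∀ {m n} → Matrix m n → Matrix n m
  M † = MoorePenrose.inverse (moorePenrose M)

  abstract

    infix 4 _⊥ker?_
    _⊥ker?_ : ∀ {m n} (a : Vector Carrier n) (B : Matrix m n) → Dec (a ⊥ker B)
    _⊥ker?_ {m} {n} a B = map′ to from (Fin.all? (λ j → (row ⊗ (B † ⊗ B)) zero j ≟ a j))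
      where
      row : Matrix 1 n
      row _ = a

      to : (∀ j → (row ⊗ (B † ⊗ B)) zero j ≈ a j) → a ⊥ker B
      to aP≈a x Bx≈0 = begin
        a ∙ x                            ≈⟨ sum-cong-≋ (λ j → *-congʳ {x = x j} (aP≈a j)) ⟨
        (row ⊗ (B † ⊗ B) ⊗ col) zero zero  ≈⟨ ⊗-congʳ col (⊗-assoc row (B †) B) zero zero ⟨
        (row ⊗ B † ⊗ B ⊗ col) zero zero    ≈⟨ ⊗-assoc (row ⊗ B †) B col zero zero ⟩
        (row ⊗ B † ⊗ (B ⊗ col)) zero zero  ≈⟨ ∑-zero (λ k → trans (*-congˡ (Bx≈0 k)) (zeroʳ _)) ⟩
        0#                               ∎
        where
        col : Matrix n 1
        col k _ = x k

      from : a ⊥ker B → ∀ j → (row ⊗ (B † ⊗ B)) zero j ≈ a j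
      from a⊥ j = sym (x-y≈0⇒x≈y (begin
        a j - (row ⊗ (B † ⊗ B)) zero j            ≈⟨ +-congʳ (∑-δ a j) ⟨
        (row ⊗ δ) zero j - (row ⊗ (B † ⊗ B)) zero j ≈⟨ ⊗-distribˡ-⊖ row δ (B † ⊗ B) zero j ⟨
        (row ⊗ (δ ⊖ B † ⊗ B)) zero j              ≈⟨ a⊥ (λ k → (δ ⊖ B † ⊗ B) k j) B[1-P]≈0 ⟩
        0#                                        ∎))
        where
        B[1-P]≈0 : ∀ i → (B ⊗ (δ ⊖ B † ⊗ B)) i j ≈ 0#
        B[1-P]≈0 i = begin
          (B ⊗ (δ ⊖ B † ⊗ B)) i j             ≈⟨ ⊗-distribˡ-⊖ B δ (B † ⊗ B) i j ⟩
          (B ⊗ δ) i j - (B ⊗ (B † ⊗ B)) i j   ≈⟨ +-cong (∑-δ (B i) j) (-‿cong (sym (⊗-assoc B (B †) B i j))) ⟩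
          B i j - (B ⊗ B † ⊗ B) i j           ≈⟨ x≈y⇒x-y≈0 (sym (MoorePenrose.M⊗P⊗M (moorePenrose B) i j)) ⟩
          0#                                  ∎

  Carrier∞ : Set c
  Carrier∞ = Carrier ⁺

  open AddSupremum _≤_ public using () renaming (_≤⁺_ to _≤∞_)

  infixl 6 _+∞_
  _+∞_ : Carrier∞ → Carrier∞ → Carrier∞
  [ x ] +∞ [ y ] = [ x + y ]
  [ x ] +∞ ⊤⁺    = ⊤⁺
  ⊤⁺    +∞ _     = ⊤⁺

  1/∞_ : Carrier∞ → Carrier∞
  1/∞ ⊤⁺    = [ 0# ]
  1/∞ [ x ] with x ≟ 0#
  ... | yes _ = ⊤⁺
  ... | no  _ = [ x ⁻¹ ]

  -- Only meaningful for a positive scalar.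
  scale : Carrier → Carrier∞ → Carrier∞
  scale w [ x ] = [ w * x ]
  scale w ⊤⁺    = ⊤⁺

  ∑∞ : ∀ {n} → Vector Carrier∞ n → Carrier∞
  ∑∞ = Vector.foldr _+∞_ [ 0# ]

  quadraticForm : ∀ {n} → Matrix n n → Vector Carrier n → Carrier
  quadraticForm {n} M a = ∑[ k < n ] ∑[ l < n ] (a k * M k l * a l)

  τ : ∀ {n d} → Matrix n d → Fin n → Carrier
  τ A i = quadraticForm ((A ᵀ ⊗ A) †) (A i)

  generalizedτ : ∀ {n′ n d} → Matrix n′ d → Matrix n d → Fin n → Carrier∞
  generalizedτ B A i with A i ⊥ker? B
  ... | yes _ = [ quadraticForm ((B ᵀ ⊗ B) †) (A i) ]
  ... | no  _ = ⊤⁺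

  indicator : ∀ {n} → Subset n → Matrix n n
  indicator S i j = if does ((i Fin.≟ j) ×-dec (i ∈? S)) then 1# else 0#

  τ̃ : ∀ {n d} → Matrix n d → Subset n → Fin n → Carrier∞
  τ̃ A S i with i ∈? S
  ... | yes _ = generalizedτ (indicator S ⊗ A) A i
  ... | no  _ = 1/∞ ([ 1# ] +∞ 1/∞ (generalizedτ (indicator S ⊗ A) A i))

  allSubsets : ∀ n → List (Subset n)
  allSubsets zero    = Vec.[] ∷ []
  allSubsets (suc n) = List.map (outside Vec.∷_) (allSubsets n) ++ List.map (inside Vec.∷_) (allSubsets n)

  subsetsOfSize : ∀ n → ℕ → List (Subset n)
  subsetsOfSize n m = filter (λ S → ∣ S ∣ ℕ.≟ m) (allSubsets n)

  -- The expectation of X (S) for S uniform among the m-element subsets;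
  -- there is at least one such subset when m ≤ n.
  𝔼 : ∀ {n} → ℕ → (Subset n → Carrier∞) → Carrier∞
  𝔼 {n} m X = scale (fromℕ (length Ω) ⁻¹) (List.foldr (λ S t → X S +∞ t) [ 0# ] Ω)
    where Ω = subsetsOfSize n m

{-# OPTIONS --safe #-}
module Submission where

-- Write σ_S(i) for a_iᵀ (A_SᵀA_S)⁺ a_i. By Sherman-Morrison τ̃_i = σ_{S ∪ i}(i) for every i, in S or not.
-- If BᵀB y = a then aᵀ(BᵀB)⁺a = a·y = max_x (2 a·x - ‖B x‖²), which can only grow when rows of B are
-- dropped; this is the lower bound. For the expectation put F_T(i) = d - m σ_T(i). As the leverage scores
-- of A_T add up to at most d, Σ_{i∈T} F_T(i) ≥ 0 as soon as |T| ≥ m. Now Σ_{|S|=m} Σ_i F_{S∪i}(i) splits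
-- into these sums over all T with |T| = m (the terms with i ∈ S) and all T with |T| = m + 1 (the terms
-- with i ∉ S), so it is nonnegative, which is the claim multiplied by m times the number of sets S.

open import Defs
import Algebra.Properties.CommutativeSemigroup as CommutativeSemigroupProperties
import Algebra.Properties.Ring as RingProperties
import Algebra.Properties.Semiring.Mult as SemiringMult
import Algebra.Properties.Semiring.Sum as SemiringSum
open import Data.Bool.Base using (Bool; true; false; not; if_then_else_)
open import Data.Fin.Base as Fin using (Fin)
import Data.Fin.Properties as Fin
open import Data.Fin.Subset using (Subset; ∣_∣; inside; outside)
open import Data.Fin.Subset.Properties using (_∈?_)
open import Data.List.Base as List using (List; []; _∷_; _++_; length; filter)
open import Data.Nat.Base as ℕ using (ℕ)
import Data.Nat.Properties as ℕ
open import Data.Product.Base using (∃-syntax; _×_; _,_; proj₁; proj₂)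
open import Data.Sum.Base using (_⊎_; inj₁; inj₂)
open import Data.Vec.Base as Vec using (lookup; _[_]≔_)
import Data.Vec.Properties as Vec
open import Data.Vec.Functional using (Vector)
open import Function.Base using (_∘_)
open import Level using (Level)
open import Relation.Binary.Bundles using (Poset)
import Relation.Binary.Construct.Add.Supremum.NonStrict as Sup
open import Relation.Binary.PropositionalEquality as ≡ using (_≡_)
open import Relation.Binary.Structures using (IsDecTotalOrder)
open import Relation.Nullary.Construct.Add.Supremum using ([_]; ⊤⁺)
open import Relation.Nullary.Decidable.Core using (Dec; yes; no; does)
open import Relation.Nullary.Negation.Core using (¬_; contradiction)
open import Relation.Unary using (Pred; Decidable)

-- Inequalities, inverses and finite sums in an ordered field.

module OrderedFieldProperties {c ℓ₁ ℓ₂ : Level} (R : CompleteOrderedField c ℓ₁ ℓ₂) where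

  open CompleteOrderedField R
  open LeverageScores R using (x*x≥0; ⁻¹-inverseʳ; ∑-nonNegative; x≤x+y)
  open RingProperties ring
  open SemiringSum semiring

  poset : Poset c ℓ₁ ℓ₂
  poset = record { isPartialOrder = IsDecTotalOrder.isPartialOrder isDecTotalOrder }

  open import Relation.Binary.Reasoning.PartialOrder poset public

  x-y+y≈x : ∀ x y → x - y + y ≈ x
  x-y+y≈x x y = begin-equality
    x - y + y      ≈⟨ +-assoc x (- y) y ⟩
    x + (- y + y)  ≈⟨ +-congˡ (-‿inverseˡ y) ⟩
    x + 0#         ≈⟨ +-identityʳ x ⟩
    x              ∎

  +-mono-≤ : ∀ {w x y z} → w ≤ x → y ≤ z → w + y ≤ x + z
  +-mono-≤ {w} {x} {y} {z} w≤x y≤z = begin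
    w + y  ≤⟨ +-monoʳ-≤ w y≤z ⟩
    w + z  ≈⟨ +-comm w z ⟩
    z + w  ≤⟨ +-monoʳ-≤ z w≤x ⟩
    z + x  ≈⟨ +-comm z x ⟩
    x + z  ∎

  x≤y⇒0≤y-x : ∀ {x y} → x ≤ y → 0# ≤ y - x
  x≤y⇒0≤y-x {x} {y} x≤y = begin
    0#     ≈⟨ -‿inverseˡ x ⟨
    - x + x ≤⟨ +-monoʳ-≤ (- x) x≤y ⟩
    - x + y  ≈⟨ +-comm (- x) y ⟩
    y - x  ∎

  0≤y-x⇒x≤y : ∀ {x y} → 0# ≤ y - x → x ≤ y
  0≤y-x⇒x≤y {x} {y} 0≤y-x = begin
    x            ≤⟨ x≤x+y x 0≤y-x ⟩
    x + (y - x)  ≈⟨ +-comm x (y - x) ⟩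
    y - x + x    ≈⟨ x-y+y≈x y x ⟩
    y            ∎

  *-monoʳ-≤ : ∀ {z x y} → 0# ≤ z → x ≤ y → z * x ≤ z * y
  *-monoʳ-≤ {z} {x} {y} 0≤z x≤y = 0≤y-x⇒x≤y (begin
    0#             ≤⟨ *-nonNegative 0≤z (x≤y⇒0≤y-x x≤y) ⟩
    z * (y - x)    ≈⟨ x[y-z]≈xy-xz z y x ⟩
    z * y - z * x  ∎)

  *-monoˡ-≤ : ∀ {z x y} → 0# ≤ z → x ≤ y → x * z ≤ y * z
  *-monoˡ-≤ {z} {x} {y} 0≤z x≤y = begin
    x * z  ≈⟨ *-comm x z ⟩
    z * x  ≤⟨ *-monoʳ-≤ 0≤z x≤y ⟩
    z * y  ≈⟨ *-comm z y ⟩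
    y * z  ∎

  0≤1 : 0# ≤ 1#
  0≤1 = ≤-trans (x*x≥0 1#) (≤-reflexive (*-identityʳ 1#))

  1+x≉0 : ∀ {x} → 0# ≤ x → ¬ 1# + x ≈ 0#
  1+x≉0 {x} 0≤x 1+x≈0 = 0≉1 (≤-antisym 0≤1 (begin
    1#      ≤⟨ x≤x+y 1# 0≤x ⟩
    1# + x  ≈⟨ 1+x≈0 ⟩
    0#      ∎))

  ⁻¹-unique : ∀ {x y} → x * y ≈ 1# → x ⁻¹ ≈ y
  ⁻¹-unique {x} {y} xy≈1 = begin-equality
    x ⁻¹            ≈⟨ *-identityʳ (x ⁻¹) ⟨
    x ⁻¹ * 1#       ≈⟨ *-congˡ xy≈1 ⟨
    x ⁻¹ * (x * y)  ≈⟨ *-assoc (x ⁻¹) x y ⟨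
    x ⁻¹ * x * y    ≈⟨ *-congʳ (trans (*-comm (x ⁻¹) x) (⁻¹-inverseʳ x≉0)) ⟩
    1# * y          ≈⟨ *-identityˡ y ⟩
    y               ∎
    where
    x≉0 : ¬ x ≈ 0#
    x≉0 x≈0 = 0≉1 (trans (sym (zeroˡ y)) (trans (*-congʳ (sym x≈0)) xy≈1))

  ⁻¹-nonNegative : ∀ {x} → 0# ≤ x → 0# ≤ x ⁻¹
  ⁻¹-nonNegative {x} 0≤x with x ≟ 0#
  ... | yes _  = ≤-refl
  ... | no x≉0 = begin
    -- The inverse y equals x y², a product of nonnegative factors.
    0#                ≤⟨ *-nonNegative 0≤x (x*x≥0 y) ⟩
    x * (y * y)       ≈⟨ *-assoc x y y ⟨
    x * y * y         ≈⟨ *-congʳ (proj₂ (proj₂ (invertible x x≉0))) ⟩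
    1# * y            ≈⟨ *-identityˡ y ⟩
    y                 ∎
    where y = proj₁ (invertible x x≉0)

  -- An inequality and not an equation, because the junk value 0⁻¹ = 0 makes the product 0 at x = 0.
  -- This is the form in which `average-≤` cancels the number of samples.
  x⁻¹*x≤1 : ∀ x → x ⁻¹ * x ≤ 1#
  x⁻¹*x≤1 x with x ≟ 0#
  ... | yes _  = ≤-trans (≤-reflexive (zeroˡ x)) 0≤1
  ... | no x≉0 = ≤-reflexive (proj₁ (proj₂ (invertible x x≉0)))

  -- 0 ≤ (x - y)², arranged so that it sums to the vector case without cancellation.
  square-gap : ∀ x y → 0# ≤ (x * x - x * y) - (y * x - y * y)
  square-gap x y = begin
    0#                                 ≤⟨ x*x≥0 (x - y) ⟩
    (x - y) * (x - y)                  ≈⟨ [y-z]x≈yx-zx (x - y) x y ⟩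
    x * (x - y) - y * (x - y)          ≈⟨ +-cong (x[y-z]≈xy-xz x x y) (-‿cong (x[y-z]≈xy-xz y x y)) ⟩
    (x * x - x * y) - (y * x - y * y)  ∎

  -- Expanding (1 - x)² ≥ 0 gives 1 - x ≥ x - x², and the right side is nonnegative by hypothesis.
  x*x≤x⇒x≤1 : ∀ {x} → x * x ≤ x → x ≤ 1#
  x*x≤x⇒x≤1 {x} xx≤x = 0≤y-x⇒x≤y (begin
    0#                ≤⟨ x≤y⇒0≤y-x (≤-trans xx≤x (≤-reflexive (sym (*-identityʳ x)))) ⟩
    x * 1# - x * x    ≤⟨ 0≤y-x⇒x≤y (square-gap 1# x) ⟩
    1# * 1# - 1# * x  ≈⟨ +-cong (*-identityʳ 1#) (-‿cong (*-identityˡ x)) ⟩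
    1# - x            ∎)

  ∑-mono-≤ : ∀ {n} {f g : Vector Carrier n} → (∀ i → f i ≤ g i) → sum f ≤ sum g
  ∑-mono-≤ {ℕ.zero}  f≤g = ≤-refl
  ∑-mono-≤ {ℕ.suc n} f≤g = +-mono-≤ (f≤g Fin.zero) (∑-mono-≤ (f≤g ∘ Fin.suc))

  term≤∑ : ∀ {n} {f : Vector Carrier n} → (∀ i → 0# ≤ f i) → ∀ i → f i ≤ sum f
  term≤∑ 0≤f Fin.zero = x≤x+y _ (∑-nonNegative (0≤f ∘ Fin.suc))
  term≤∑ {f = f} 0≤f (Fin.suc i) = begin
    f (Fin.suc i)               ≤⟨ term≤∑ (0≤f ∘ Fin.suc) i ⟩
    sum (f ∘ Fin.suc)           ≈⟨ +-identityˡ _ ⟨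
    0# + sum (f ∘ Fin.suc)      ≤⟨ +-mono-≤ (0≤f Fin.zero) ≤-refl ⟩
    sum f                       ∎

  fromℕ-nonNegative : ∀ k → 0# ≤ fromℕ k
  fromℕ-nonNegative ℕ.zero    = ≤-refl
  fromℕ-nonNegative (ℕ.suc k) = ≤-trans 0≤1 (x≤x+y 1# (fromℕ-nonNegative k))

  fromℕ-mono-≤ : ∀ {j k} → j ℕ.≤ k → fromℕ j ≤ fromℕ k
  fromℕ-mono-≤ {k = k} ℕ.z≤n   = fromℕ-nonNegative k
  fromℕ-mono-≤ (ℕ.s≤s j≤k)     = +-monoʳ-≤ 1# (fromℕ-mono-≤ j≤k)

  fromℕ-≉0 : ∀ {k} → 1 ℕ.≤ k → ¬ fromℕ k ≈ 0#
  fromℕ-≉0 {ℕ.suc k} _ = 1+x≉0 (fromℕ-nonNegative k)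

  ∑-const : ∀ n x → ∑[ _ < n ] x ≈ fromℕ n * x
  ∑-const ℕ.zero    x = sym (zeroˡ x)
  ∑-const (ℕ.suc n) x = begin-equality
    x + ∑[ _ < n ] x        ≈⟨ +-cong (sym (*-identityˡ x)) (∑-const n x) ⟩
    1# * x + fromℕ n * x    ≈⟨ distribʳ x 1# (fromℕ n) ⟨
    (1# + fromℕ n) * x      ∎

-- Gram matrices, their linear systems and quadratic forms of the pseudoinverse.

module GramProperties {c ℓ₁ ℓ₂ : Level} (R : CompleteOrderedField c ℓ₁ ℓ₂) where

  open CompleteOrderedField R hiding (zero; _/_; fromℕ)
  open LeverageScores R
  open OrderedFieldProperties R
  open SemiringSum semiring

  -- The precedence lies between `∙` and the postfix operators, so that `u ∙ M ᵀ ·ᵛ x` is the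
  -- product of u with the vector Mᵀ x.
  infixr 7.5 _·ᵛ_
  _·ᵛ_ : ∀ {m n} → Matrix m n → Vector Carrier n → Vector Carrier m
  (M ·ᵛ x) i = M i ∙ x

  gram : ∀ {m n} → Matrix m n → Matrix n n
  gram B = B ᵀ ⊗ B

  -- Solutions of BᵀB y = a stand in for the pseudoinverse: any one of them determines aᵀ(BᵀB)⁺a as
  -- a·y, so later proofs only have to exhibit a vector.
  infix 4 _solves_⟨_⟩
  _solves_⟨_⟩ : ∀ {m n} → Vector Carrier n → Matrix m n → Vector Carrier n → Set ℓ₁
  y solves B ⟨ a ⟩ = ∀ j → (gram B ·ᵛ y) j ≈ a j

  ∙-congˡ : ∀ {n} (u : Vector Carrier n) {v w} → (∀ i → v i ≈ w i) → u ∙ v ≈ u ∙ w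
  ∙-congˡ u v≈w = sum-cong-≋ (λ i → *-congˡ (v≈w i))

  ∙-congʳ : ∀ {n} {u v} (w : Vector Carrier n) → (∀ i → u i ≈ v i) → u ∙ w ≈ v ∙ w
  ∙-congʳ w u≈v = sum-cong-≋ (λ i → *-congʳ (u≈v i))

  ∙-comm : ∀ {n} (u v : Vector Carrier n) → u ∙ v ≈ v ∙ u
  ∙-comm u v = sum-cong-≋ (λ i → *-comm (u i) (v i))

  ∙-zeroʳ : ∀ {n} (u : Vector Carrier n) {v} → (∀ i → v i ≈ 0#) → u ∙ v ≈ 0#
  ∙-zeroʳ u v≈0 = ∑-zero (λ i → trans (*-congˡ (v≈0 i)) (zeroʳ (u i)))

  ∙-scaleʳ : ∀ {n} (u v : Vector Carrier n) x → u ∙ (λ i → v i * x) ≈ (u ∙ v) * x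
  ∙-scaleʳ u v x = begin-equality
    u ∙ (λ i → v i * x)              ≈⟨ sum-cong-≋ (λ i → *-assoc (u i) (v i) x) ⟨
    sum (λ i → u i * v i * x)        ≈⟨ *-distribʳ-sum x (λ i → u i * v i) ⟨
    (u ∙ v) * x                      ∎

  ·ᵛ-⊗ : ∀ {m n p} (M : Matrix m n) (N : Matrix n p) x i → ((M ⊗ N) ·ᵛ x) i ≈ (M ·ᵛ N ·ᵛ x) i
  -- The vector is read as a matrix with one column.
  ·ᵛ-⊗ M N x i = ⊗-assoc M N (λ k (_ : Fin 1) → x k) i Fin.zero

  ∙-adjoint : ∀ {m n} (M : Matrix m n) u x → u ∙ M ·ᵛ x ≈ (M ᵀ ·ᵛ u) ∙ x
  ∙-adjoint M u x = begin-equality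
    u ∙ M ·ᵛ x                    ≈⟨ ⊗-assoc (λ (_ : Fin 1) → u) M (λ k (_ : Fin 1) → x k) Fin.zero Fin.zero ⟨
    (λ j → u ∙ (M ᵀ) j) ∙ x       ≈⟨ ∙-congʳ x (λ j → ∙-comm u ((M ᵀ) j)) ⟩
    (M ᵀ ·ᵛ u) ∙ x                ∎

  quadraticForm-∙ : ∀ {n} (P : Matrix n n) a → quadraticForm P a ≈ a ∙ P ·ᵛ a
  quadraticForm-∙ P a = sum-cong-≋ (λ k → begin-equality
    sum (λ l → a k * P k l * a l)    ≈⟨ sum-cong-≋ (λ l → *-assoc (a k) (P k l) (a l)) ⟩
    sum (λ l → a k * (P k l * a l))  ≈⟨ *-distribˡ-sum (a k) (λ l → P k l * a l) ⟨
    a k * (P ·ᵛ a) k                 ∎)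

  quadraticForm-cong : ∀ {n} (P : Matrix n n) {a b} → (∀ i → a i ≈ b i) → quadraticForm P a ≈ quadraticForm P b
  quadraticForm-cong P a≈b = sum-cong-≋ (λ k → sum-cong-≋ (λ l → *-cong (*-congʳ (a≈b k)) (a≈b l)))

  gram-sym : ∀ {m n} (B : Matrix m n) → gram B ᵀ ≋ gram B
  gram-sym B = ᵀ-⊗ (B ᵀ) B

  gram-∙ : ∀ {m n} (B : Matrix m n) y x → (gram B ·ᵛ y) ∙ x ≈ (B ·ᵛ y) ∙ (B ·ᵛ x)
  gram-∙ B y x = begin-equality
    (gram B ·ᵛ y) ∙ x        ≈⟨ ∙-congʳ x (·ᵛ-⊗ (B ᵀ) B y) ⟩
    (B ᵀ ·ᵛ B ·ᵛ y) ∙ x      ≈⟨ ∙-adjoint B (B ·ᵛ y) x ⟨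
    (B ·ᵛ y) ∙ (B ·ᵛ x)      ∎

  -- If BᵀB x = 0 then ‖B x‖² = x·BᵀB x = 0, and a vanishing sum of squares vanishes termwise.
  gram-kernel : ∀ {m n} (B : Matrix m n) x → (∀ j → (gram B ·ᵛ x) j ≈ 0#) → ∀ i → B i ∙ x ≈ 0#
  gram-kernel B x Gx≈0 i = x*x≈0⇒x≈0 (∑≈0⇒≈0 (λ k → x*x≥0 (B k ∙ x)) (begin-equality
    (B ·ᵛ x) ∙ (B ·ᵛ x)  ≈⟨ gram-∙ B x x ⟨
    (gram B ·ᵛ x) ∙ x    ≈⟨ ∙-comm (gram B ·ᵛ x) x ⟩
    x ∙ (gram B ·ᵛ x)    ≈⟨ ∙-zeroʳ x Gx≈0 ⟩
    0#                   ∎) i)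

  solves-∙ : ∀ {m n} (B : Matrix m n) {a y} → y solves B ⟨ a ⟩ → ∀ x → a ∙ x ≈ (B ·ᵛ y) ∙ (B ·ᵛ x)
  solves-∙ B {a} {y} Gy≈a x = trans (∙-congʳ x (λ j → sym (Gy≈a j))) (gram-∙ B y x)

  solves⇒⊥ker : ∀ {m n} (B : Matrix m n) {a y} → y solves B ⟨ a ⟩ → a ⊥ker B
  solves⇒⊥ker B {y = y} Gy≈a x Bx≈0 = trans (solves-∙ B Gy≈a x) (∙-zeroʳ (B ·ᵛ y) Bx≈0)

  solves-nonNegative : ∀ {m n} (B : Matrix m n) {a y} → y solves B ⟨ a ⟩ → 0# ≤ a ∙ y
  solves-nonNegative B {a} {y} Gy≈a = begin
    0#                   ≤⟨ ∑-nonNegative (λ k → x*x≥0 (B k ∙ y)) ⟩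
    (B ·ᵛ y) ∙ (B ·ᵛ y)  ≈⟨ solves-∙ B Gy≈a y ⟨
    a ∙ y                ∎

  -- With G = BᵀB symmetric and a = G y, the form aᵀG⁺a is yᵀG G⁺G y, and the Penrose equation G G⁺G
  -- = G reduces it to yᵀG y = a·y.
  quadraticForm-† : ∀ {m n} (B : Matrix m n) {a y} → y solves B ⟨ a ⟩ → quadraticForm (gram B †) a ≈ a ∙ y
  quadraticForm-† B {a} {y} Gy≈a = begin-equality
    quadraticForm (G †) a                 ≈⟨ quadraticForm-∙ (G †) a ⟩
    a ∙ G † ·ᵛ a                          ≈⟨ ∙-congʳ (G † ·ᵛ a) (λ j → trans (∙-congʳ y (λ k → gram-sym B j k)) (Gy≈a j)) ⟨
    (G ᵀ ·ᵛ y) ∙ G † ·ᵛ a                 ≈⟨ ∙-adjoint G y (G † ·ᵛ a) ⟨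
    y ∙ G ·ᵛ G † ·ᵛ a                     ≈⟨ ∙-congˡ y GG†a≈a ⟩
    y ∙ a                                 ≈⟨ ∙-comm y a ⟩
    a ∙ y                                 ∎
    where
    G = gram B
    GG†a≈a : ∀ j → (G ·ᵛ G † ·ᵛ a) j ≈ a j
    GG†a≈a j = begin-equality
      (G ·ᵛ G † ·ᵛ a) j        ≈⟨ ·ᵛ-⊗ G (G †) a j ⟨
      ((G ⊗ G †) ·ᵛ a) j       ≈⟨ ∙-congˡ ((G ⊗ G †) j) Gy≈a ⟨
      ((G ⊗ G †) ·ᵛ G ·ᵛ y) j  ≈⟨ ·ᵛ-⊗ (G ⊗ G †) G y j ⟨
      ((G ⊗ G † ⊗ G) ·ᵛ y) j   ≈⟨ ∙-congʳ y (MoorePenrose.M⊗P⊗M (moorePenrose G) j) ⟩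
      (G ·ᵛ y) j               ≈⟨ Gy≈a j ⟩
      a j                      ∎

  -- The Fredholm alternative, made decidable by testing a against the columns of I - G⁺G, where G =
  -- BᵀB. If all products vanish, a = (G⁺G)ᵀa = G (G⁺)ᵀa gives a solution. Otherwise some column q
  -- has a·q nonzero; it lies in the kernel of G, hence of B, and is divided by a·q.
  solve : ∀ {m n} (B : Matrix m n) a →
          (∃[ y ] y solves B ⟨ a ⟩) ⊎ (∃[ x ] (∀ i → B i ∙ x ≈ 0#) × a ∙ x ≈ 1#)
  solve {m} {n} B a with Fin.all? (λ j → a ∙ Q j ≟ 0#)
    where
    Q : Matrix n n
    Q = (δ ⊖ gram B † ⊗ gram B) ᵀ
  ... | yes aQ≈0 = inj₁ (G † ᵀ ·ᵛ a , λ j → begin-equality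
    (G ·ᵛ G † ᵀ ·ᵛ a) j         ≈⟨ ·ᵛ-⊗ G (G † ᵀ) a j ⟨
    ((G ⊗ G † ᵀ) ·ᵛ a) j        ≈⟨ ∙-congʳ a (λ k → GG†ᵀ≈P k j) ⟩
    (P ᵀ) j ∙ a                 ≈⟨ ∙-comm ((P ᵀ) j) a ⟩
    a ∙ (P ᵀ) j                 ≈⟨ x-y≈0⇒x≈y (trans (sym (aδ-aP j)) (aQ≈0 j)) ⟨
    a ∙ (δ ᵀ) j                 ≈⟨ ∑-δ a j ⟩
    a j                         ∎)
    where
    G P : Matrix n n
    G = gram B
    P = G † ⊗ G
    GG†ᵀ≈P : ∀ k j → (G ⊗ G † ᵀ) j k ≈ P k j
    GG†ᵀ≈P k j = begin-equality
      (G ⊗ G † ᵀ) j k     ≈⟨ ⊗-congʳ (G † ᵀ) (gram-sym B) j k ⟨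
      (G ᵀ ⊗ G † ᵀ) j k   ≈⟨ ᵀ-⊗ (G †) G j k ⟨
      P k j               ∎
    aδ-aP : ∀ j → a ∙ ((δ ⊖ P) ᵀ) j ≈ a ∙ (δ ᵀ) j - a ∙ (P ᵀ) j
    aδ-aP j = ⊗-distribˡ-⊖ (λ (_ : Fin 1) → a) δ P Fin.zero j
  ... | no ¬aQ≈0 = inj₂ ((λ k → q k * (a ∙ q) ⁻¹) , (λ i → begin-equality
    B i ∙ (λ k → q k * (a ∙ q) ⁻¹)  ≈⟨ ∙-scaleʳ (B i) q ((a ∙ q) ⁻¹) ⟩
    (B i ∙ q) * (a ∙ q) ⁻¹          ≈⟨ *-congʳ (gram-kernel B q Gq≈0 i) ⟩
    0# * (a ∙ q) ⁻¹                 ≈⟨ zeroˡ _ ⟩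
    0#                              ∎) , (begin-equality
    a ∙ (λ k → q k * (a ∙ q) ⁻¹)    ≈⟨ ∙-scaleʳ a q ((a ∙ q) ⁻¹) ⟩
    (a ∙ q) * (a ∙ q) ⁻¹            ≈⟨ ⁻¹-inverseʳ (proj₂ witness) ⟩
    1#                              ∎))
    where
    G P : Matrix n n
    G = gram B
    P = G † ⊗ G
    witness : ∃[ j ] ¬ a ∙ ((δ ⊖ P) ᵀ) j ≈ 0#
    witness = Fin.¬∀⟶∃¬ n _ (λ j → a ∙ ((δ ⊖ P) ᵀ) j ≟ 0#) ¬aQ≈0
    j : Fin n
    j = proj₁ witness
    q : Vector Carrier n
    q k = (δ ⊖ P) k j
    Gq≈0 : ∀ i → (G ·ᵛ q) i ≈ 0#
    Gq≈0 i = begin-equality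
      (G ⊗ (δ ⊖ P)) i j              ≈⟨ ⊗-distribˡ-⊖ G δ P i j ⟩
      (G ⊗ δ) i j - (G ⊗ P) i j      ≈⟨ +-cong (∑-δ (G i) j) (-‿cong (sym (⊗-assoc G (G †) G i j))) ⟩
      G i j - (G ⊗ G † ⊗ G) i j      ≈⟨ x≈y⇒x-y≈0 (sym (MoorePenrose.M⊗P⊗M (moorePenrose G) i j)) ⟩
      0#                             ∎

  ⊥ker⇒solves : ∀ {m n} (B : Matrix m n) {a} → a ⊥ker B → ∃[ y ] y solves B ⟨ a ⟩
  ⊥ker⇒solves B {a} a⊥ with solve B a
  ... | inj₁ solution          = solution
  ... | inj₂ (x , Bx≈0 , ax≈1) = contradiction (trans (sym (a⊥ x Bx≈0)) ax≈1) 0≉1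

  -- Both sides are values of the maximum over x of 2 a·x - ‖B x‖², resp. 2 a·x - ‖C x‖².
  quadraticForm-†-anti-mono : ∀ {m m′ n} (B : Matrix m n) (C : Matrix m′ n) {a} →
    (∀ x → (B ·ᵛ x) ∙ (B ·ᵛ x) ≤ (C ·ᵛ x) ∙ (C ·ᵛ x)) → a ⊥ker B → a ⊥ker C →
    quadraticForm (gram C †) a ≤ quadraticForm (gram B †) a
  quadraticForm-†-anti-mono B C {a} ‖B‖≤‖C‖ a⊥B a⊥C
    with ⊥ker⇒solves B a⊥B | ⊥ker⇒solves C a⊥C
  ... | y , By | z , Cz = begin
    quadraticForm (gram C †) a   ≈⟨ quadraticForm-† C Cz ⟩
    a ∙ z                        ≤⟨ 0≤y-x⇒x≤y (≤-trans 0≤q-r q-r≤p-q) ⟩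
    a ∙ y                        ≈⟨ quadraticForm-† B By ⟨
    quadraticForm (gram B †) a   ∎
    where
    u = B ·ᵛ y
    v = B ·ᵛ z
    0≤q-r : 0# ≤ a ∙ z - v ∙ v
    0≤q-r = x≤y⇒0≤y-x (begin
      v ∙ v                ≤⟨ ‖B‖≤‖C‖ z ⟩
      (C ·ᵛ z) ∙ (C ·ᵛ z)  ≈⟨ solves-∙ C Cz z ⟨
      a ∙ z                ∎)
    -- With p = a·y, q = a·z and r = ‖B z‖², this is ‖B y - B z‖² ≥ 0 expanded, summed entrywise
    -- from `square-gap`.
    q-r≤p-q : a ∙ z - v ∙ v ≤ a ∙ y - a ∙ z
    q-r≤p-q = begin
      a ∙ z - v ∙ v                            ≈⟨ +-congʳ (trans (solves-∙ B By z) (∙-comm u v)) ⟩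
      v ∙ u - v ∙ v                            ≈⟨ ∑-minus (λ i → v i * u i) (λ i → v i * v i) ⟨
      sum (λ i → v i * u i - v i * v i)        ≤⟨ ∑-mono-≤ (λ i → 0≤y-x⇒x≤y (square-gap (u i) (v i))) ⟩
      sum (λ i → u i * u i - u i * v i)        ≈⟨ ∑-minus (λ i → u i * u i) (λ i → u i * v i) ⟩
      u ∙ u - u ∙ v                            ≈⟨ +-cong (solves-∙ B By y) (-‿cong (solves-∙ B By z)) ⟨
      a ∙ y - a ∙ z                            ∎

  -- Symmetry and idempotence make the diagonal entry the squared norm of its row, so it is at least
  -- its own square.
  projection-diagonal≤1 : ∀ {n} (P : Matrix n n) → P ᵀ ≋ P → P ⊗ P ≋ P → ∀ i → P i i ≤ 1#
  projection-diagonal≤1 P Pᵀ≋P PP≋P i = x*x≤x⇒x≤1 (begin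
    P i i * P i i                 ≤⟨ term≤∑ (λ k → x*x≥0 (P i k)) i ⟩
    sum (λ k → P i k * P i k)     ≈⟨ sum-cong-≋ (λ k → *-congˡ (Pᵀ≋P k i)) ⟩
    (P ⊗ P) i i                   ≈⟨ PP≋P i i ⟩
    P i i                         ∎)

  -- Exchanging the sums turns the total into the trace of G⁺G with G = BᵀB, a symmetric idempotent
  -- whose d diagonal entries are each at most 1.
  ∑τ≤d : ∀ {n d} (B : Matrix n d) → sum (τ B) ≤ fromℕ d
  ∑τ≤d {n} {d} B = begin
    ∑[ i < n ] ∑[ k < d ] ∑[ l < d ] (B i k * (G †) k l * B i l)
      ≈⟨ ∑-comm (λ i k → ∑[ l < d ] (B i k * (G †) k l * B i l)) ⟩
    ∑[ k < d ] ∑[ i < n ] ∑[ l < d ] (B i k * (G †) k l * B i l)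
      ≈⟨ sum-cong-≋ (λ k → ∑-comm (λ i l → B i k * (G †) k l * B i l)) ⟩
    ∑[ k < d ] ∑[ l < d ] ∑[ i < n ] (B i k * (G †) k l * B i l)
      ≈⟨ sum-cong-≋ (λ k → sum-cong-≋ (λ l → sum-cong-≋ (λ i → rearrange (B i k) ((G †) k l) (B i l)))) ⟩
    ∑[ k < d ] ∑[ l < d ] ∑[ i < n ] ((G †) k l * (B i l * B i k))
      ≈⟨ sum-cong-≋ (λ k → sum-cong-≋ (λ l → *-distribˡ-sum ((G †) k l) (λ i → B i l * B i k))) ⟨
    ∑[ k < d ] (G † ⊗ G) k k
      ≤⟨ ∑-mono-≤ (projection-diagonal≤1 (G † ⊗ G) (MoorePenrose.P⊗M-sym (moorePenrose G)) idempotent) ⟩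
    ∑[ _ < d ] 1#
      ≈⟨ ∑-const d 1# ⟩
    fromℕ d * 1#
      ≈⟨ *-identityʳ (fromℕ d) ⟩
    fromℕ d ∎
    where
    G : Matrix d d
    G = gram B
    rearrange : ∀ x y z → x * y * z ≈ y * (z * x)
    rearrange x y z = trans (*-congʳ (*-comm x y)) (trans (*-assoc y x z) (*-congˡ (*-comm x z)))
    idempotent : G † ⊗ G ⊗ (G † ⊗ G) ≋ G † ⊗ G
    idempotent = ≋-trans (≋-sym (⊗-assoc (G † ⊗ G) (G †) G))
                         (⊗-congʳ G (MoorePenrose.P⊗M⊗P (moorePenrose G)))

-- Membership weights and the extended reciprocal.

module SampledLeverage {c ℓ₁ ℓ₂ : Level} (R : CompleteOrderedField c ℓ₁ ℓ₂) where

  open CompleteOrderedField R hiding (zero; _/_; fromℕ)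
  open LeverageScores R
  open OrderedFieldProperties R
  open GramProperties R
  open SemiringSum semiring

  ι : Bool → Carrier
  ι b = if b then 1# else 0#

  ι-nonNegative : ∀ b → 0# ≤ ι b
  ι-nonNegative true  = 0≤1
  ι-nonNegative false = ≤-refl

  ι*-≤ : ∀ b {x} → 0# ≤ x → ι b * x ≤ x
  ι*-≤ true  0≤x = ≤-reflexive (*-identityˡ _)
  ι*-≤ false 0≤x = ≤-trans (≤-reflexive (zeroˡ _)) 0≤x

  ι-absorb : ∀ b x y → (ι b * x) * (ι b * y) ≈ ι b * (x * y)
  ι-absorb true  x y = trans (*-cong (*-identityˡ x) (*-identityˡ y)) (sym (*-identityˡ (x * y)))
  ι-absorb false x y = trans (*-congʳ (zeroˡ x)) (trans (zeroˡ _) (sym (zeroˡ (x * y))))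

  -- `indicator` decides membership with `∈?`, while the weighted sums below use `lookup`; this
  -- joins the two.
  does-∈? : ∀ {n} (i : Fin n) (S : Subset n) → does (i ∈? S) ≡ lookup S i
  does-∈? Fin.zero    (true Vec.∷ S)  = ≡.refl
  does-∈? Fin.zero    (false Vec.∷ S) = ≡.refl
  does-∈? (Fin.suc i) (_ Vec.∷ S)     = does-∈? i S

  ∑-insert : ∀ {n} (S : Subset n) i → lookup S i ≡ outside → ∀ (f : Vector Carrier n) →
             sum (λ k → ι (lookup (S [ i ]≔ inside) k) * f k) ≈ sum (λ k → ι (lookup S k) * f k) + f i
  ∑-insert S i i∉S f = begin-equality
    sum (λ k → ι (lookup (S [ i ]≔ inside) k) * f k)       ≈⟨ sum-cong-≋ term ⟩
    sum (λ k → ι (lookup S k) * f k + f k * δ k i)         ≈⟨ ∑-distrib-+ (λ k → ι (lookup S k) * f k) (λ k → f k * δ k i) ⟩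
    sum (λ k → ι (lookup S k) * f k) + sum (λ k → f k * δ k i)  ≈⟨ +-congˡ (∑-δ f i) ⟩
    sum (λ k → ι (lookup S k) * f k) + f i                 ∎
    where
    term : ∀ k → ι (lookup (S [ i ]≔ inside) k) * f k ≈ ι (lookup S k) * f k + f k * δ k i
    term k with k Fin.≟ i
    ... | yes ≡.refl rewrite Vec.lookup∘update i S inside | i∉S =
      trans (*-comm 1# (f i)) (trans (sym (+-identityˡ _)) (+-congʳ (sym (zeroˡ (f i)))))
    ... | no k≢i rewrite Vec.lookup∘update′ k≢i S inside =
      trans (sym (+-identityʳ _)) (+-congˡ (sym (zeroʳ (f k))))

  insert-∈ : ∀ {n} (S : Subset n) i → lookup S i ≡ inside → S [ i ]≔ inside ≡ S
  insert-∈ S i i∈S = ≡.trans (≡.cong (S [ i ]≔_) (≡.sym i∈S)) (Vec.[]≔-lookup S i)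

  1/∞-≈0 : ∀ {x} → x ≈ 0# → 1/∞ [ x ] ≡ ⊤⁺
  1/∞-≈0 {x} x≈0 with x ≟ 0#
  ... | yes _  = ≡.refl
  ... | no x≉0 = contradiction x≈0 x≉0

  1/∞-≉0 : ∀ {x} → ¬ x ≈ 0# → 1/∞ [ x ] ≡ [ x ⁻¹ ]
  1/∞-≉0 {x} x≉0 with x ≟ 0# in eq
  ... | yes x≈0 = contradiction x≈0 x≉0
  ... | no _ rewrite eq = ≡.refl

  generalizedτ-⊥ker : ∀ {n′ n d} (B : Matrix n′ d) (A : Matrix n d) i → A i ⊥ker B →
                      generalizedτ B A i ≡ [ quadraticForm (gram B †) (A i) ]
  generalizedτ-⊥ker B A i a⊥B with A i ⊥ker? B
  ... | yes _   = ≡.refl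
  ... | no ¬a⊥B = contradiction a⊥B ¬a⊥B

  generalizedτ-¬⊥ker : ∀ {n′ n d} (B : Matrix n′ d) (A : Matrix n d) i → ¬ A i ⊥ker B →
                       generalizedτ B A i ≡ ⊤⁺
  generalizedτ-¬⊥ker B A i ¬a⊥B with A i ⊥ker? B
  ... | yes a⊥B = contradiction a⊥B ¬a⊥B
  ... | no _    = ≡.refl

  -- Scores relative to a sample, and the effect of adding one row.

  module _ {n d : ℕ} (A : Matrix n d) where

    restrict : Subset n → Matrix n d
    restrict S = indicator S ⊗ A

    -- The finite branch of `generalizedτ` without its orthogonality test, so that sums of scores
    -- stay in `Carrier`.
    σ : Subset n → Fin n → Carrier
    σ S i = quadraticForm (gram (restrict S) †) (A i)

    restrict-row : ∀ S i j → restrict S i j ≈ ι (lookup S i) * A i j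
    restrict-row S i j = trans (sum-cong-≋ term) (∑-δ (λ k → ι (lookup S i) * A k j) i)
      where
      term : ∀ k → indicator S i k * A k j ≈ ι (lookup S i) * A k j * δ k i
      -- `indicator` compares i with k and `δ` compares k with i, so both decisions are split and
      -- the mixed cases refuted.
      term k with i Fin.≟ k | k Fin.≟ i
      ... | yes _      | yes _  rewrite does-∈? i S = sym (*-identityʳ _)
      ... | yes i≡k    | no k≢i = contradiction (≡.sym i≡k) k≢i
      ... | no i≢k     | yes k≡i = contradiction (≡.sym k≡i) i≢k
      ... | no _       | no _   = trans (zeroˡ _) (sym (zeroʳ _))

    restrict-∙ : ∀ S i x → restrict S i ∙ x ≈ ι (lookup S i) * (A i ∙ x)
    restrict-∙ S i x = begin-equality
      restrict S i ∙ x                                ≈⟨ ∙-congʳ x (restrict-row S i) ⟩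
      sum (λ j → ι (lookup S i) * A i j * x j)        ≈⟨ sum-cong-≋ (λ j → *-assoc (ι (lookup S i)) (A i j) (x j)) ⟩
      sum (λ j → ι (lookup S i) * (A i j * x j))      ≈⟨ *-distribˡ-sum (ι (lookup S i)) (λ j → A i j * x j) ⟨
      ι (lookup S i) * (A i ∙ x)                      ∎

    -- A sampled row survives as row i of `restrict S`, so the kernel annihilates it; sampled rows
    -- therefore never score ∞.
    ∈⇒⊥ker-restrict : ∀ S i → lookup S i ≡ inside → A i ⊥ker restrict S
    ∈⇒⊥ker-restrict S i i∈S x Bx≈0 = begin-equality
      A i ∙ x                        ≈⟨ *-identityˡ (A i ∙ x) ⟨
      1# * (A i ∙ x)                 ≡⟨ ≡.cong (λ b → ι b * (A i ∙ x)) i∈S ⟨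
      ι (lookup S i) * (A i ∙ x)     ≈⟨ restrict-∙ S i x ⟨
      restrict S i ∙ x               ≈⟨ Bx≈0 i ⟩
      0#                             ∎

    row-⊥ker : ∀ i → A i ⊥ker A
    row-⊥ker i x Ax≈0 = Ax≈0 i

    gram-restrict : ∀ S y j → (gram (restrict S) ·ᵛ y) j ≈ sum (λ k → ι (lookup S k) * (A k j * (A k ∙ y)))
    gram-restrict S y j = begin-equality
      (gram (restrict S) ·ᵛ y) j                                      ≈⟨ ·ᵛ-⊗ (restrict S ᵀ) (restrict S) y j ⟩
      sum (λ k → restrict S k j * (restrict S k ∙ y))                 ≈⟨ sum-cong-≋ (λ k → *-cong (restrict-row S k j) (restrict-∙ S k y)) ⟩
      sum (λ k → ι (lookup S k) * A k j * (ι (lookup S k) * (A k ∙ y)))  ≈⟨ sum-cong-≋ (λ k → ι-absorb (lookup S k) (A k j) (A k ∙ y)) ⟩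
      sum (λ k → ι (lookup S k) * (A k j * (A k ∙ y)))                ∎

    -- The rank-one update: adding row i adds a_i a_iᵀ to the Gram matrix, here applied to a vector
    -- y.
    gram-insert : ∀ S i → lookup S i ≡ outside → ∀ y j →
                  (gram (restrict (S [ i ]≔ inside)) ·ᵛ y) j ≈ (gram (restrict S) ·ᵛ y) j + A i j * (A i ∙ y)
    gram-insert S i i∉S y j = begin-equality
      (gram (restrict (S [ i ]≔ inside)) ·ᵛ y) j   ≈⟨ gram-restrict (S [ i ]≔ inside) y j ⟩
      sum (λ k → ι (lookup (S [ i ]≔ inside) k) * (A k j * (A k ∙ y)))
                                                   ≈⟨ ∑-insert S i i∉S (λ k → A k j * (A k ∙ y)) ⟩
      sum (λ k → ι (lookup S k) * (A k j * (A k ∙ y))) + A i j * (A i ∙ y)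
                                                   ≈⟨ +-congʳ (gram-restrict S y j) ⟨
      (gram (restrict S) ·ᵛ y) j + A i j * (A i ∙ y)  ∎

    -- Zeroing rows can only shrink ‖A x‖², so monotonicity of the quadratic form applies; i being
    -- in S supplies the orthogonality to the smaller matrix's kernel.
    τ≤σ : ∀ S i → lookup S i ≡ inside → τ A i ≤ σ S i
    τ≤σ S i i∈S = quadraticForm-†-anti-mono (restrict S) A
      (λ x → ∑-mono-≤ (λ k → begin
        (restrict S k ∙ x) * (restrict S k ∙ x)
          ≈⟨ *-cong (restrict-∙ S k x) (restrict-∙ S k x) ⟩
        (ι (lookup S k) * (A k ∙ x)) * (ι (lookup S k) * (A k ∙ x))
          ≈⟨ ι-absorb (lookup S k) (A k ∙ x) (A k ∙ x) ⟩
        ι (lookup S k) * ((A k ∙ x) * (A k ∙ x))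
          ≤⟨ ι*-≤ (lookup S k) (x*x≥0 (A k ∙ x)) ⟩
        (A k ∙ x) * (A k ∙ x) ∎))
      (∈⇒⊥ker-restrict S i i∈S) (row-⊥ker i)

    -- Row i of `restrict S` is a_i for i in S and zero otherwise, so the weighted scores are
    -- exactly the leverage scores of `restrict S`.
    ∑σ≤d : ∀ S → sum (λ i → ι (lookup S i) * σ S i) ≤ fromℕ d
    ∑σ≤d S = begin
      sum (λ i → ι (lookup S i) * σ S i)  ≈⟨ sum-cong-≋ (λ i → term i) ⟨
      sum (τ (restrict S))                ≤⟨ ∑τ≤d (restrict S) ⟩
      fromℕ d                             ∎
      where
      P = gram (restrict S) †
      term : ∀ i → τ (restrict S) i ≈ ι (lookup S i) * σ S i
      term i with lookup S i in eq
      ... | true = trans (quadraticForm-cong P (λ j → trans (restrict-row S i j)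
                     (trans (*-congʳ (reflexive (≡.cong ι eq))) (*-identityˡ (A i j))))) (sym (*-identityˡ (σ S i)))
      ... | false = trans (quadraticForm-∙ P (restrict S i)) (trans (∑-zero (λ j → trans
                      (*-congʳ (trans (restrict-row S i j)
                        (trans (*-congʳ (reflexive (≡.cong ι eq))) (zeroˡ (A i j))))) (zeroˡ _)))
                      (sym (zeroˡ (σ S i))))

    -- The Sherman-Morrison solution: (G + a aᵀ) y = (1 + a·y) a, and 1 + a·y is invertible because
    -- a·y = ‖B y‖² ≥ 0 with B = `restrict S`.
    solves-insert : ∀ S i → lookup S i ≡ outside → ∀ {y} → y solves restrict S ⟨ A i ⟩ →
                    (λ j → y j * (1# + A i ∙ y) ⁻¹) solves restrict (S [ i ]≔ inside) ⟨ A i ⟩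
    solves-insert S i i∉S {y} Gy≈a j = begin-equality
      (G′ ·ᵛ (λ k → y k * s)) j              ≈⟨ ∙-scaleʳ (G′ j) y s ⟩
      (G′ ·ᵛ y) j * s                        ≈⟨ *-congʳ (gram-insert S i i∉S y j) ⟩
      ((gram (restrict S) ·ᵛ y) j + A i j * t) * s  ≈⟨ *-congʳ (+-congʳ (trans (Gy≈a j) (sym (*-identityʳ (A i j))))) ⟩
      (A i j * 1# + A i j * t) * s           ≈⟨ *-congʳ (distribˡ (A i j) 1# t) ⟨
      A i j * (1# + t) * s                   ≈⟨ *-assoc (A i j) (1# + t) s ⟩
      A i j * ((1# + t) * s)                 ≈⟨ *-congˡ (⁻¹-inverseʳ (1+x≉0 (solves-nonNegative (restrict S) Gy≈a))) ⟩
      A i j * 1#                             ≈⟨ *-identityʳ (A i j) ⟩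
      A i j                                  ∎
      where
      G′ = gram (restrict (S [ i ]≔ inside))
      t s : Carrier
      t = A i ∙ y
      s = (1# + t) ⁻¹

    -- The old Gram matrix annihilates x, and the new rank-one term sends it to (a_i·x) a_i = a_i.
    solves-insert-kernel : ∀ S i → lookup S i ≡ outside → ∀ {x} → (∀ k → restrict S k ∙ x ≈ 0#) → A i ∙ x ≈ 1# →
                           x solves restrict (S [ i ]≔ inside) ⟨ A i ⟩
    solves-insert-kernel S i i∉S {x} Bx≈0 ax≈1 j = begin-equality
      (gram (restrict (S [ i ]≔ inside)) ·ᵛ x) j       ≈⟨ gram-insert S i i∉S x j ⟩
      (gram (restrict S) ·ᵛ x) j + A i j * (A i ∙ x)   ≈⟨ +-cong (·ᵛ-⊗ (restrict S ᵀ) (restrict S) x j) (*-congˡ ax≈1) ⟩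
      (restrict S ᵀ) j ∙ (restrict S ·ᵛ x) + A i j * 1#  ≈⟨ +-cong (∙-zeroʳ ((restrict S ᵀ) j) Bx≈0) (*-identityʳ (A i j)) ⟩
      0# + A i j                                       ≈⟨ +-identityˡ (A i j) ⟩
      A i j                                            ∎

    -- The Sherman-Morrison identity τ_i(A_{S ∪ i}) = 1 / (1 + 1 / τ_i^{SA}(A)).
    τ̃-outside : ∀ S i → lookup S i ≡ outside →
                ∃[ v ] 1/∞ ([ 1# ] +∞ 1/∞ generalizedτ (restrict S) A i) ≡ [ v ] × v ≈ σ (S [ i ]≔ inside) i
    τ̃-outside S i i∉S with solve (restrict S) (A i)
    -- Here a_i is not orthogonal to the kernel, so its score is ∞ and the formula gives 1/(1 + 0) =
    -- 1. The kernel vector x solves the enlarged system, with value a_i·x = 1 as well.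
    ... | inj₂ (x , Bx≈0 , ax≈1)
      rewrite generalizedτ-¬⊥ker (restrict S) A i (λ a⊥B → 0≉1 (trans (sym (a⊥B x Bx≈0)) ax≈1))
      = _ , 1/∞-≉0 (1+x≉0 ≤-refl) , (begin-equality
        (1# + 0#) ⁻¹             ≈⟨ ⁻¹-unique (trans (*-identityʳ _) (+-identityʳ 1#)) ⟩
        1#                       ≈⟨ ax≈1 ⟨
        A i ∙ x                  ≈⟨ quadraticForm-† (restrict (S [ i ]≔ inside)) (solves-insert-kernel S i i∉S Bx≈0 ax≈1) ⟨
        σ (S [ i ]≔ inside) i    ∎)
    ... | inj₁ (y , Gy≈a)
      rewrite generalizedτ-⊥ker (restrict S) A i (solves⇒⊥ker (restrict S) Gy≈a)
      = formula (σ S i ≟ 0#)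
      where
      t s : Carrier
      t = A i ∙ y
      s = (1# + t) ⁻¹
      0≤t : 0# ≤ t
      0≤t = solves-nonNegative (restrict S) Gy≈a
      σ≈t : σ S i ≈ t
      σ≈t = quadraticForm-† (restrict S) Gy≈a
      σ′≈ts : σ (S [ i ]≔ inside) i ≈ t * s
      σ′≈ts = trans (quadraticForm-† (restrict (S [ i ]≔ inside)) (solves-insert S i i∉S Gy≈a))
                    (∙-scaleʳ (A i) y s)
      formula : Dec (σ S i ≈ 0#) →
                ∃[ v ] 1/∞ ([ 1# ] +∞ 1/∞ [ σ S i ]) ≡ [ v ] × v ≈ σ (S [ i ]≔ inside) i
      -- The conventions give 1/(1 + 1/0) = 1/∞ = 0, which agrees with t/(1 + t) at t = 0.
      formula (yes σ≈0) rewrite 1/∞-≈0 σ≈0 =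
        0# , ≡.refl , sym (trans σ′≈ts (trans (*-congʳ (trans (sym σ≈t) σ≈0)) (zeroˡ s)))
      -- The inverse of 1 + 1/t is t/(1 + t), since (1 + 1/t) t = t + 1.
      formula (no σ≉0) rewrite 1/∞-≉0 σ≉0 =
        _ , 1/∞-≉0 (1+x≉0 0≤σ⁻¹) , trans (⁻¹-unique (begin-equality
          (1# + σ S i ⁻¹) * (t * s)         ≈⟨ *-assoc (1# + σ S i ⁻¹) t s ⟨
          (1# + σ S i ⁻¹) * t * s           ≈⟨ *-congʳ (distribʳ t 1# (σ S i ⁻¹)) ⟩
          (1# * t + σ S i ⁻¹ * t) * s       ≈⟨ *-congʳ (+-cong (*-identityˡ t) (trans (*-comm (σ S i ⁻¹) t) (*-congʳ (sym σ≈t)))) ⟩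
          (t + σ S i * σ S i ⁻¹) * s        ≈⟨ *-congʳ (trans (+-congˡ (⁻¹-inverseʳ σ≉0)) (+-comm t 1#)) ⟩
          (1# + t) * s                      ≈⟨ ⁻¹-inverseʳ (1+x≉0 0≤t) ⟩
          1#                                ∎)) (sym σ′≈ts)
        where
        0≤σ⁻¹ : 0# ≤ σ S i ⁻¹
        0≤σ⁻¹ = ⁻¹-nonNegative (≤-trans 0≤t (≤-reflexive (sym σ≈t)))

    -- For i in S the insertion changes nothing; for i outside it is Sherman-Morrison. Finiteness is
    -- a propositional equation, ready for rewriting, while the value is only known up to `≈`.
    τ̃-σ : ∀ S i → ∃[ v ] τ̃ A S i ≡ [ v ] × v ≈ σ (S [ i ]≔ inside) i
    τ̃-σ S i with i ∈? S
    ... | yes i∈S = _ , generalizedτ-⊥ker (restrict S) A i (∈⇒⊥ker-restrict S i lookup≡) ,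
                    reflexive (≡.cong (λ T → σ T i) (≡.sym (insert-∈ S i lookup≡)))
      where lookup≡ = Vec.[]=⇒lookup i∈S
    ... | no i∉S = τ̃-outside S i (outsider (lookup S i) ≡.refl)
      where
      outsider : ∀ b → lookup S i ≡ b → lookup S i ≡ outside
      outsider true  p = contradiction (Vec.lookup⇒[]= i S p) i∉S
      outsider false p = p

    -- The set S ∪ i always contains i, so `τ≤σ` covers sampled and unsampled rows at once.
    τ≤τ̃ : ∀ S i → [ τ A i ] ≤∞ τ̃ A S i
    τ≤τ̃ S i with τ̃-σ S i
    ... | v , eq , v≈σ rewrite eq =
      Sup.[ ≤-trans (τ≤σ (S [ i ]≔ inside) i (Vec.lookup∘update i S inside)) (≤-reflexive (sym v≈σ)) ]

-- Sums over lists of subsets.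

module Expectation {c ℓ₁ ℓ₂ : Level} (R : CompleteOrderedField c ℓ₁ ℓ₂) where

  open CompleteOrderedField R hiding (zero; _/_; fromℕ)
  open LeverageScores R
  open OrderedFieldProperties R
  open SampledLeverage R
  open CommutativeSemigroupProperties +-commutativeSemigroup using (interchange)
  open RingProperties ring
  open SemiringSum semiring
  open SemiringMult semiring using (×1-homo-*)

  private variable
    n : ℕ
    ℓ : Level
    X : Set ℓ

  ∑ₗ : List X → (X → Carrier) → Carrier
  ∑ₗ xs f = List.foldr (λ x t → f x + t) 0# xs

  ∑ₗ-cong : ∀ (xs : List X) {f g} → (∀ x → f x ≈ g x) → ∑ₗ xs f ≈ ∑ₗ xs g
  ∑ₗ-cong []       f≈g = refl
  ∑ₗ-cong (x ∷ xs) f≈g = +-cong (f≈g x) (∑ₗ-cong xs f≈g)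

  ∑ₗ-nonNegative : ∀ (xs : List X) {f} → (∀ x → 0# ≤ f x) → 0# ≤ ∑ₗ xs f
  ∑ₗ-nonNegative []       0≤f = ≤-refl
  ∑ₗ-nonNegative (x ∷ xs) 0≤f = ≤-trans (0≤f x) (x≤x+y _ (∑ₗ-nonNegative xs 0≤f))

  ∑ₗ-distrib-+ : ∀ (xs : List X) f g → ∑ₗ xs (λ x → f x + g x) ≈ ∑ₗ xs f + ∑ₗ xs g
  ∑ₗ-distrib-+ []       f g = sym (+-identityˡ 0#)
  ∑ₗ-distrib-+ (x ∷ xs) f g = trans (+-congˡ (∑ₗ-distrib-+ xs f g)) (interchange (f x) (g x) _ _)

  ∑ₗ-++ : ∀ (xs ys : List X) f → ∑ₗ (xs ++ ys) f ≈ ∑ₗ xs f + ∑ₗ ys f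
  ∑ₗ-++ []       ys f = sym (+-identityˡ _)
  ∑ₗ-++ (x ∷ xs) ys f = trans (+-congˡ (∑ₗ-++ xs ys f)) (sym (+-assoc _ _ _))

  ∑ₗ-map : ∀ {Y : Set ℓ} (h : X → Y) xs f → ∑ₗ (List.map h xs) f ≈ ∑ₗ xs (f ∘ h)
  ∑ₗ-map h []       f = refl
  ∑ₗ-map h (x ∷ xs) f = +-congˡ (∑ₗ-map h xs f)

  ∑ₗ-affine : ∀ (xs : List X) a b f → ∑ₗ xs (λ x → a - b * f x) ≈ fromℕ (length xs) * a - b * ∑ₗ xs f
  ∑ₗ-affine [] a b f = sym (trans (+-cong (zeroˡ a) (trans (-‿cong (zeroʳ b)) -0#≈0#)) (+-identityˡ 0#))
  ∑ₗ-affine (x ∷ xs) a b f = begin-equality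
    (a - b * f x) + ∑ₗ xs (λ x → a - b * f x)
      ≈⟨ +-congˡ (∑ₗ-affine xs a b f) ⟩
    (a - b * f x) + (fromℕ (length xs) * a - b * ∑ₗ xs f)
      ≈⟨ interchange a _ _ _ ⟩
    (a + fromℕ (length xs) * a) + (- (b * f x) - b * ∑ₗ xs f)
      ≈⟨ +-cong (+-congʳ (sym (*-identityˡ a))) (-‿+-comm (b * f x) (b * ∑ₗ xs f)) ⟩
    (1# * a + fromℕ (length xs) * a) - (b * f x + b * ∑ₗ xs f)
      ≈⟨ +-cong (sym (distribʳ a 1# (fromℕ (length xs)))) (-‿cong (sym (distribˡ b (f x) (∑ₗ xs f)))) ⟩
    (1# + fromℕ (length xs)) * a - b * (f x + ∑ₗ xs f) ∎

  -- Turns the restriction to m-element sets into a 0-1 weight, so that the recursion over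
  -- `allSubsets` can be used.
  ∑ₗ-filter : ∀ {P : Pred X ℓ} (P? : Decidable P) xs f →
              ∑ₗ (filter P? xs) f ≈ ∑ₗ xs (λ x → ι (does (P? x)) * f x)
  ∑ₗ-filter P? []       f = refl
  ∑ₗ-filter P? (x ∷ xs) f with does (P? x)
  ... | true  = +-cong (sym (*-identityˡ (f x))) (∑ₗ-filter P? xs f)
  ... | false = trans (∑ₗ-filter P? xs f) (sym (trans (+-congʳ (zeroˡ (f x))) (+-identityˡ _)))

  ∑-affine : ∀ {n} a b (w f : Vector Carrier n) →
             sum (λ i → w i * (a - b * f i)) ≈ sum w * a - b * sum (λ i → w i * f i)
  ∑-affine a b w f = begin-equality
    sum (λ i → w i * (a - b * f i))                       ≈⟨ sum-cong-≋ (λ i → trans (x[y-z]≈xy-xz (w i) a (b * f i)) (+-congˡ (-‿cong (swap (w i) b (f i))))) ⟩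
    sum (λ i → w i * a - b * (w i * f i))                 ≈⟨ ∑-minus (λ i → w i * a) (λ i → b * (w i * f i)) ⟩
    sum (λ i → w i * a) - sum (λ i → b * (w i * f i))     ≈⟨ +-cong (*-distribʳ-sum a w) (-‿cong (*-distribˡ-sum b (λ i → w i * f i))) ⟨
    sum w * a - b * sum (λ i → w i * f i)                 ∎
    where
    swap : ∀ x y z → x * (y * z) ≈ y * (x * z)
    swap x y z = trans (sym (*-assoc x y z)) (trans (*-congʳ (*-comm x y)) (*-assoc y x z))

  ∑-ι-lookup : ∀ (S : Subset n) → sum (λ i → ι (lookup S i)) ≈ fromℕ ∣ S ∣
  ∑-ι-lookup Vec.[]            = refl
  ∑-ι-lookup (true  Vec.∷ S)   = +-congˡ (∑-ι-lookup S)
  ∑-ι-lookup (false Vec.∷ S)   = trans (+-identityˡ _) (∑-ι-lookup S)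

  ∑ₗ-allSubsets : ∀ (f : Subset (ℕ.suc n) → Carrier) →
    ∑ₗ (allSubsets (ℕ.suc n)) f ≈ ∑ₗ (allSubsets n) (f ∘ (outside Vec.∷_)) + ∑ₗ (allSubsets n) (f ∘ (inside Vec.∷_))
  ∑ₗ-allSubsets {n} f = trans (∑ₗ-++ (List.map (outside Vec.∷_) (allSubsets n)) _ f)
    (+-cong (∑ₗ-map (outside Vec.∷_) (allSubsets n) f) (∑ₗ-map (inside Vec.∷_) (allSubsets n) f))

  -- Double counting of pairs of a subset and an index.

  ∑∉ ∑∈ : (Subset n → Fin n → Carrier) → Subset n → Carrier
  ∑∉ F S = sum (λ i → ι (not (lookup S i)) * F (S [ i ]≔ inside) i)
  ∑∈ F T = sum (λ i → ι (lookup T i) * F T i)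

  -- (S , i) ↦ (S ∪ {i} , i) is a bijection from the pairs with i ∉ S to the pairs with i ∈ S.
  double-count : ∀ (F : Subset n → Fin n → Carrier) → ∑ₗ (allSubsets n) (∑∉ F) ≈ ∑ₗ (allSubsets n) (∑∈ F)
  double-count {ℕ.zero}  F = refl
  double-count {ℕ.suc n} F = begin-equality
    ∑ₗ (allSubsets (ℕ.suc n)) (∑∉ F)
      ≈⟨ ∑ₗ-allSubsets (∑∉ F) ⟩
    ∑ₗ Ω (λ S → 1# * new S + ∑∉ F₀ S) + ∑ₗ Ω (λ S → 0# * new S + ∑∉ F₁ S)
      ≈⟨ +-cong (∑ₗ-distrib-+ Ω _ _) (∑ₗ-distrib-+ Ω _ _) ⟩
    (∑ₗ Ω (λ S → 1# * new S) + ∑ₗ Ω (∑∉ F₀)) + (∑ₗ Ω (λ S → 0# * new S) + ∑ₗ Ω (∑∉ F₁))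
      ≈⟨ +-cong (+-congˡ (double-count F₀)) (+-congˡ (double-count F₁)) ⟩
    (∑ₗ Ω (λ S → 1# * new S) + ∑ₗ Ω (∑∈ F₀)) + (∑ₗ Ω (λ S → 0# * new S) + ∑ₗ Ω (∑∈ F₁))
      -- Inserting index 0 carries a set without 0 to one with 0, so the live contribution of that
      -- index moves from the outside half to the inside half.
      ≈⟨ exchange _ _ _ _ ⟩
    (∑ₗ Ω (λ S → 0# * new S) + ∑ₗ Ω (∑∈ F₀)) + (∑ₗ Ω (λ S → 1# * new S) + ∑ₗ Ω (∑∈ F₁))
      -- The dead terms of index 0 evaluate F at different sets on the two sides; both carry weight
      -- 0.
      ≈⟨ +-congʳ (+-congʳ (∑ₗ-cong Ω (λ S → trans (zeroˡ (new S)) (sym (zeroˡ (F (outside Vec.∷ S) Fin.zero)))))) ⟩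
    (∑ₗ Ω (λ S → 0# * F (outside Vec.∷ S) Fin.zero) + ∑ₗ Ω (∑∈ F₀)) + (∑ₗ Ω (λ S → 1# * new S) + ∑ₗ Ω (∑∈ F₁))
      ≈⟨ +-cong (∑ₗ-distrib-+ Ω _ _) (∑ₗ-distrib-+ Ω _ _) ⟨
    ∑ₗ Ω (λ T → 0# * F (outside Vec.∷ T) Fin.zero + ∑∈ F₀ T) + ∑ₗ Ω (λ T → 1# * new T + ∑∈ F₁ T)
      ≈⟨ ∑ₗ-allSubsets (∑∈ F) ⟨
    ∑ₗ (allSubsets (ℕ.suc n)) (∑∈ F) ∎
    where
    Ω : List (Subset n)
    Ω = allSubsets n
    new : Subset n → Carrier
    new S = F (inside Vec.∷ S) Fin.zero
    F₀ F₁ : Subset n → Fin n → Carrier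
    F₀ S i = F (outside Vec.∷ S) (Fin.suc i)
    F₁ S i = F (inside Vec.∷ S) (Fin.suc i)
    exchange : ∀ w x y z → (w + x) + (y + z) ≈ (y + x) + (w + z)
    exchange w x y z = begin-equality
      (w + x) + (y + z)  ≈⟨ +-congʳ (+-comm w x) ⟩
      (x + w) + (y + z)  ≈⟨ interchange x w y z ⟩
      (x + y) + (w + z)  ≈⟨ +-congʳ (+-comm x y) ⟩
      (y + x) + (w + z)  ∎

  ∣insert∣ : ∀ (S : Subset n) i → lookup S i ≡ outside → ∣ S [ i ]≔ inside ∣ ≡ ℕ.suc ∣ S ∣
  ∣insert∣ (false Vec.∷ S) Fin.zero    _   = ≡.refl
  ∣insert∣ (true  Vec.∷ S) (Fin.suc i) i∉S = ≡.cong ℕ.suc (∣insert∣ S i i∉S)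
  ∣insert∣ (false Vec.∷ S) (Fin.suc i) i∉S = ∣insert∣ S i i∉S

  -- Pairs with i in S give the sums `∑∈ F` over m-element sets; pairs with i outside S, reindexed
  -- by T = S ∪ i, give those over sets of size m + 1. Each such sum is nonnegative by hypothesis.
  ∑-insert-nonNegative : ∀ (m : ℕ) (F : Subset n → Fin n → Carrier) →
    (∀ T → m ℕ.≤ ∣ T ∣ → 0# ≤ ∑∈ F T) →
    0# ≤ ∑ₗ (subsetsOfSize n m) (λ S → sum (λ i → F (S [ i ]≔ inside) i))
  ∑-insert-nonNegative {n} m F 0≤F = begin
    0#
      ≤⟨ ≤-trans (∑ₗ-nonNegative Ω (λ T → weighted (∣ T ∣ ℕ.≟ m) T ℕ.≤-reflexive))
           (x≤x+y _ (∑ₗ-nonNegative Ω (λ T → weighted (ℕ.pred ∣ T ∣ ℕ.≟ m) T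
             (λ eq → ℕ.≤-trans (ℕ.≤-reflexive eq) ℕ.pred[n]≤n)))) ⟩
    ∑ₗ Ω (λ S → w S * ∑∈ F S) + ∑ₗ Ω (λ T → w′ T * ∑∈ F T)
      ≈⟨ +-congˡ (∑ₗ-cong Ω (λ T → pull (w′ T) (λ i → ι (lookup T i)) (F T))) ⟩
    ∑ₗ Ω (λ S → w S * ∑∈ F S) + ∑ₗ Ω (λ T → ∑∈ F′ T)
      ≈⟨ +-congˡ (double-count F′) ⟨
    ∑ₗ Ω (λ S → w S * ∑∈ F S)
      + ∑ₗ Ω (λ S → ∑∉ F′ S)
      ≈⟨ ∑ₗ-distrib-+ Ω _ _ ⟨
    ∑ₗ Ω (λ S → w S * ∑∈ F S + ∑∉ F′ S)
      ≈⟨ ∑ₗ-cong Ω merge ⟩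
    ∑ₗ Ω (λ S → w S * sum (λ i → F (S [ i ]≔ inside) i))
      ≈⟨ ∑ₗ-filter (λ S → ∣ S ∣ ℕ.≟ m) Ω _ ⟨
    ∑ₗ (subsetsOfSize n m) (λ S → sum (λ i → F (S [ i ]≔ inside) i)) ∎
    where
    Ω : List (Subset n)
    Ω = allSubsets n
    w w′ : Subset n → Carrier
    w S  = ι (does (∣ S ∣ ℕ.≟ m))
    -- Encodes ∣T∣ = m + 1 so that for i outside S the weight of S ∪ i computes to that of S. For m
    -- = 0 the empty set passes too, but its sum over members is empty.
    w′ T = ι (does (ℕ.pred ∣ T ∣ ℕ.≟ m))
    F′ : Subset n → Fin n → Carrier
    -- The weight is put inside F, so that `double-count` carries it along from T to S ∪ i.
    F′ T i = w′ T * F T i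

    weighted : ∀ {k} (k≟m : Dec (k ≡ m)) T → (m ≡ k → m ℕ.≤ ∣ T ∣) →
               0# ≤ ι (does k≟m) * ∑∈ F T
    weighted (yes k≡m) T m≤ = *-nonNegative 0≤1 (0≤F T (m≤ (≡.sym k≡m)))
    weighted (no _)    T m≤ = ≤-reflexive (sym (zeroˡ _))

    pull : ∀ x (u v : Vector Carrier n) → x * sum (λ i → u i * v i) ≈ sum (λ i → u i * (x * v i))
    pull x u v = trans (*-distribˡ-sum x (λ i → u i * v i))
      (sum-cong-≋ (λ i → trans (sym (*-assoc x (u i) (v i))) (trans (*-congʳ (*-comm x (u i))) (*-assoc (u i) x (v i)))))

    merge : ∀ S → w S * ∑∈ F S + ∑∉ F′ S
                  ≈ w S * sum (λ i → F (S [ i ]≔ inside) i)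
    merge S = begin-equality
      w S * ∑∈ F S + ∑∉ F′ S
        ≈⟨ +-congʳ (*-distribˡ-sum (w S) (λ i → ι (lookup S i) * F S i)) ⟩
      sum (λ i → w S * (ι (lookup S i) * F S i)) + ∑∉ F′ S
        ≈⟨ ∑-distrib-+ (λ i → w S * (ι (lookup S i) * F S i)) (λ i → ι (not (lookup S i)) * (w′ (S [ i ]≔ inside) * F (S [ i ]≔ inside) i)) ⟨
      sum (λ i → w S * (ι (lookup S i) * F S i)
        + ι (not (lookup S i)) * (w′ (S [ i ]≔ inside) * F (S [ i ]≔ inside) i))
        ≈⟨ sum-cong-≋ term ⟩
      sum (λ i → w S * F (S [ i ]≔ inside) i)
        ≈⟨ *-distribˡ-sum (w S) (λ i → F (S [ i ]≔ inside) i) ⟨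
      w S * sum (λ i → F (S [ i ]≔ inside) i) ∎
      where
      term : ∀ i → w S * (ι (lookup S i) * F S i)
                     + ι (not (lookup S i)) * (w′ (S [ i ]≔ inside) * F (S [ i ]≔ inside) i)
                   ≈ w S * F (S [ i ]≔ inside) i
      -- Exactly one summand survives: the first for i in S, where insertion leaves S alone, and the
      -- second for i outside, where the size grows by one and `pred` undoes it.
      term i with lookup S i in eq
      ... | true  rewrite insert-∈ S i eq =
        trans (+-cong (*-congˡ (*-identityˡ (F S i))) (zeroˡ _)) (+-identityʳ _)
      ... | false rewrite ∣insert∣ S i eq =
        trans (+-cong (trans (*-congˡ (zeroˡ (F S i))) (zeroʳ _)) (*-identityˡ _)) (+-identityˡ _)

  -- Reduction of extended sums to the field, and averaging.

  ∑∞-finite : ∀ {n} {f : Vector Carrier∞ n} {g : Vector Carrier n} → (∀ i → ∃[ v ] f i ≡ [ v ] × v ≈ g i) →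
              ∃[ v ] ∑∞ f ≡ [ v ] × v ≈ sum g
  ∑∞-finite {ℕ.zero}  f≈g = 0# , ≡.refl , refl
  ∑∞-finite {ℕ.suc n} f≈g with f≈g Fin.zero | ∑∞-finite (f≈g ∘ Fin.suc)
  ... | v , fv , v≈ | t , ft , t≈ = v + t , ≡.cong₂ _+∞_ fv ft , +-cong v≈ t≈

  ∑ₗ∞-finite : ∀ (xs : List X) {f : X → Carrier∞} {g : X → Carrier} → (∀ x → ∃[ v ] f x ≡ [ v ] × v ≈ g x) →
               ∃[ v ] List.foldr (λ x t → f x +∞ t) [ 0# ] xs ≡ [ v ] × v ≈ ∑ₗ xs g
  ∑ₗ∞-finite []       f≈g = 0# , ≡.refl , refl
  ∑ₗ∞-finite (x ∷ xs) f≈g with f≈g x | ∑ₗ∞-finite xs f≈g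
  ... | v , fv , v≈ | t , ft , t≈ = v + t , ≡.cong₂ _+∞_ fv ft , +-cong v≈ t≈

  -- Multiply the hypothesis by m⁻¹ and N⁻¹. What remains of N is N⁻¹ N ≤ 1, which against the
  -- nonnegative Y / m also covers N = 0.
  average-≤ : ∀ {N m X Y} → 0# ≤ N → 0# ≤ m → ¬ m ≈ 0# → 0# ≤ Y → m * X ≤ N * Y → N ⁻¹ * X ≤ Y / m
  average-≤ {N} {m} {X} {Y} 0≤N 0≤m m≉0 0≤Y mX≤NY = begin
    N ⁻¹ * X                      ≈⟨ *-congˡ (*-identityˡ X) ⟨
    N ⁻¹ * (1# * X)               ≈⟨ *-congˡ (*-congʳ (trans (*-comm (m ⁻¹) m) (⁻¹-inverseʳ m≉0))) ⟨
    N ⁻¹ * (m ⁻¹ * m * X)         ≈⟨ *-congˡ (*-assoc (m ⁻¹) m X) ⟩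
    N ⁻¹ * (m ⁻¹ * (m * X))       ≤⟨ *-monoʳ-≤ (⁻¹-nonNegative 0≤N) (*-monoʳ-≤ (⁻¹-nonNegative 0≤m) mX≤NY) ⟩
    N ⁻¹ * (m ⁻¹ * (N * Y))       ≈⟨ *-congˡ (*-comm (m ⁻¹) (N * Y)) ⟩
    N ⁻¹ * (N * Y * m ⁻¹)         ≈⟨ *-congˡ (*-assoc N Y (m ⁻¹)) ⟩
    N ⁻¹ * (N * (Y / m))          ≈⟨ *-assoc (N ⁻¹) N (Y / m) ⟨
    N ⁻¹ * N * (Y / m)            ≤⟨ *-monoˡ-≤ (*-nonNegative 0≤Y (⁻¹-nonNegative 0≤m)) (x⁻¹*x≤1 N) ⟩
    1# * (Y / m)                  ≈⟨ *-identityˡ (Y / m) ⟩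
    Y / m                         ∎

  -- The bound on the expected total score.

  module _ {n d : ℕ} (A : Matrix n d) (m : ℕ) where

    -- The F_T(i) of the opening comment: the comparison of σ with d / m, cleared of the division.
    excess : Subset n → Fin n → Carrier
    excess T i = fromℕ d - fromℕ m * σ A T i

    -- The chain is m Σ σ ≤ m d ≤ ∣T∣ d, with sums over the members of T.
    excess-nonNegative : ∀ T → m ℕ.≤ ∣ T ∣ → 0# ≤ ∑∈ excess T
    excess-nonNegative T m≤∣T∣ = begin
      0#
        ≤⟨ x≤y⇒0≤y-x (begin
             fromℕ m * sum (λ i → ι (lookup T i) * σ A T i)  ≤⟨ *-monoʳ-≤ (fromℕ-nonNegative m) (∑σ≤d A T) ⟩
             fromℕ m * fromℕ d                               ≤⟨ *-monoˡ-≤ (fromℕ-nonNegative d) (fromℕ-mono-≤ m≤∣T∣) ⟩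
             fromℕ ∣ T ∣ * fromℕ d                           ≈⟨ *-congʳ (∑-ι-lookup T) ⟨
             sum (λ i → ι (lookup T i)) * fromℕ d            ∎) ⟩
      sum (λ i → ι (lookup T i)) * fromℕ d - fromℕ m * sum (λ i → ι (lookup T i) * σ A T i)
        ≈⟨ ∑-affine (fromℕ d) (fromℕ m) (λ i → ι (lookup T i)) (σ A T) ⟨
      ∑∈ excess T ∎

    ∑σ : Subset n → Carrier
    ∑σ S = sum (λ i → σ A (S [ i ]≔ inside) i)

    ∑-excess : ∀ S → sum (λ i → excess (S [ i ]≔ inside) i) ≈ fromℕ (n ℕ.* d) - fromℕ m * ∑σ S
    ∑-excess S = begin-equality
      sum (λ i → fromℕ d - fromℕ m * s i)                        ≈⟨ ∑-minus (λ _ → fromℕ d) (λ i → fromℕ m * s i) ⟩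
      ∑[ _ < n ] fromℕ d - sum (λ i → fromℕ m * s i)             ≈⟨ +-cong (trans (∑-const n (fromℕ d)) (sym (×1-homo-* n d))) (-‿cong (sym (*-distribˡ-sum (fromℕ m) s))) ⟩
      fromℕ (n ℕ.* d) - fromℕ m * ∑σ S                           ∎
      where
      s : Vector Carrier n
      s i = σ A (S [ i ]≔ inside) i

    -- The expectation is first rewritten as a finite value N⁻¹ v, with N the number of samples.
    -- Summing `excess` over all samples then gives N n d - m v ≥ 0, and `average-≤` divides by N
    -- and m.
    𝔼∑τ̃≤ : 1 ℕ.≤ m → 𝔼 m (λ S → ∑∞ (τ̃ A S)) ≤∞ [ fromℕ (n ℕ.* d) / fromℕ m ]
    𝔼∑τ̃≤ 1≤m with ∑ₗ∞-finite (subsetsOfSize n m) (λ S → ∑∞-finite (τ̃-σ A S))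
    ... | v , eq , v≈ rewrite eq = Sup.[ average-≤ (fromℕ-nonNegative N) (fromℕ-nonNegative m) (fromℕ-≉0 1≤m)
          (fromℕ-nonNegative (n ℕ.* d)) (0≤y-x⇒x≤y (begin
      0#                                                             ≤⟨ ∑-insert-nonNegative m excess excess-nonNegative ⟩
      ∑ₗ Ω (λ S → sum (λ i → excess (S [ i ]≔ inside) i))            ≈⟨ ∑ₗ-cong Ω ∑-excess ⟩
      ∑ₗ Ω (λ S → fromℕ (n ℕ.* d) - fromℕ m * ∑σ S)                  ≈⟨ ∑ₗ-affine Ω (fromℕ (n ℕ.* d)) (fromℕ m) ∑σ ⟩
      fromℕ N * fromℕ (n ℕ.* d) - fromℕ m * ∑ₗ Ω ∑σ                  ≈⟨ +-congˡ (-‿cong (*-congˡ (sym v≈))) ⟩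
      fromℕ N * fromℕ (n ℕ.* d) - fromℕ m * v                        ∎)) ]
      where
      Ω : List (Subset n)
      Ω = subsetsOfSize n m
      N : ℕ
      N = length Ω

open import Data.Nat.Base using (_≤_; _*_)

theorem1 : ∀ {c ℓ₁ ℓ₂ : Level} (R : CompleteOrderedField c ℓ₁ ℓ₂) →
    let open LeverageScores R in
    ∀ {n d : ℕ} (A : Matrix n d) (m : ℕ) → 1 ≤ m → m ≤ n →
    (∀ (S : Subset n) → ∣ S ∣ ≡ m → ∀ (i : Fin n) → [ τ A i ] ≤∞ τ̃ A S i)
    × (𝔼 m (λ S → ∑∞ (τ̃ A S)) ≤∞ [ fromℕ (n * d) / fromℕ m ])
theorem1 R A m 1≤m _ = (λ S _ → τ≤τ̃ A S) , 𝔼∑τ̃≤ A m 1≤m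
  where
  open SampledLeverage R
  open Expectation R
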